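{- For any non-trivial total permutation-invariant function $f:\{0,1\}^n\times\{0,1\}^n\to\{ -1,1\}$, we have $$D(f)=O\left(\log^2\operatorname{rank}(f)\right).$$
   Context: A function $f:\{0,1\}^n\times\{0,1\}^n\to\{ -1,1\}$ is (total) permutation-invariant if $f(x^\pi,y^\pi)=f(x,y)$ for all $x,y\in\{0,1\}^n$ and every bijection $\pi$ of $\{0,\dots,n-1\}$, where $(x^\pi)_i=x_{\pi(i)}$. It is non-trivial if $f(x,y)$ does not depend only on the Hamming weights $|x|$ and $|y|$. $\operatorname{rank}(f)$ is the rank over $\mathbb{R}$ of the $2^n\times 2^n$ input matrix $M_f=[f(x,y)]_{x,y}$. $D(f)$ is the deterministic two-party communication complexity of $f$: the minimum number of bits exchanged (worst case) over deterministic protocols, where Alice holds $x$ and Bob holds $y$, that output $f(x,y)$ on every input. The constant in $O(\cdot)$ is absolute (independent of $n$ and $f$). -}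

module Defs where

open import Algebra.Bundles using (CommutativeRing)
open import Algebra.Structures using (IsCommutativeRing)
open import Data.Bool using (Bool; true; if_then_else_)
open import Data.Bool.Properties using () renaming (_≟_ to _≟ᵇ_)
open import Data.Fin using (Fin)
open import Data.Fin.Permutation using (Permutation′; _⟨$⟩ʳ_)
open import Data.Nat as ℕ using (ℕ; suc)
import Data.Nat.Properties as ℕₚ
open import Data.Product using (Σ; ∃-syntax; _×_; _,_)
open import Data.Rational as ℚ using (ℚ; 0ℚ; 1ℚ; ½; ∣_∣)
import Data.Rational.Properties as ℚₚ
open import Data.Sign using (Sign)
open import Data.Vec using (Vec; lookup; tabulate; count)
open import Level using (0ℓ)
open import Relation.Binary.PropositionalEquality
  using (_≡_; refl; sym; trans; cong; subst)
open import Relation.Nullary using (¬_)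

------------------------------------------------------------------------
-- The real numbers, as Cauchy sequences of rationals.  Since the library
-- has no quotients, equality of reals is the setoid relation _≈_.

Cauchy : (ℕ → ℚ) → Set
Cauchy s = ∀ ε → 0ℚ ℚ.< ε →
  ∃[ N ] (∀ m n → N ℕ.≤ m → N ℕ.≤ n → ∣ s m ℚ.- s n ∣ ℚ.< ε)

record ℝ : Set where
  constructor mkℝ
  field
    seq    : ℕ → ℚ
    cauchy : Cauchy seq

open ℝ public

infix 4 _≈_

-- A record rather than a plain function type, so that the two reals can
-- be inferred from a proof that they are equal.
record _≈_ (x y : ℝ) : Set where
  constructor mk≈
  field
    limit : ∀ ε → 0ℚ ℚ.< ε →
      ∃[ N ] (∀ n → N ℕ.≤ n → ∣ seq x n ℚ.- seq y n ∣ ℚ.< ε)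

open _≈_ public

private
  module RingLemmas {a ℓ} (R : CommutativeRing a ℓ) where
    open CommutativeRing R renaming (_≈_ to _≋_; refl to ≋-refl; sym to ≋-sym; trans to ≋-trans)
    open import Algebra.Properties.Ring ring
    open import Algebra.Properties.CommutativeSemigroup +-commutativeSemigroup using (interchange)
    open import Relation.Binary.Reasoning.Setoid setoid

    neg-sub : ∀ x y → - (x - y) ≋ y - x
    neg-sub = ⁻¹-anti-homo-//

    sub-add : ∀ x y → x ≋ (x - y) + y
    sub-add x y = ≋-sym (begin
      (x - y) + y      ≈⟨ +-assoc x (- y) y ⟩
      x + (- y + y)    ≈⟨ +-congˡ (-‿inverseˡ y) ⟩
      x + 0#           ≈⟨ +-identityʳ x ⟩
      x                ∎)

    telescope : ∀ x y z → x - z ≋ (x - y) + (y - z)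
    telescope x y z = begin
      x - z                ≈⟨ +-congʳ (sub-add x y) ⟩
      (x - y + y) - z      ≈⟨ +-assoc (x - y) y (- z) ⟩
      (x - y) + (y - z)    ∎

    sum-sub : ∀ x y z w → (x + y) - (z + w) ≋ (x - z) + (y - w)
    sum-sub x y z w = begin
      (x + y) - (z + w)          ≈⟨ +-congˡ (-‿+-comm z w) ⟨
      (x + y) + (- z + - w)      ≈⟨ interchange x y (- z) (- w) ⟩
      (x - z) + (y - w)          ∎

    sub-neg : ∀ x y → (- x) - (- y) ≋ y - x
    sub-neg x y = ≋-trans (+-congˡ (-‿involutive y)) (+-comm (- x) y)

    prod-sub : ∀ x y z w → x * y - z * w ≋ x * (y - w) + w * (x - z)
    prod-sub x y z w = begin
      x * y - z * w                        ≈⟨ telescope (x * y) (x * w) (z * w) ⟩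
      (x * y - x * w) + (x * w - z * w)    ≈⟨ +-cong (x[y-z]≈xy-xz x y w)
                                                (≋-trans (*-comm w (x - z)) ([y-z]x≈yx-zx w x z)) ⟨
      x * (y - w) + w * (x - z)            ∎

  open RingLemmas ℚₚ.+-*-commutativeRing

  half : ℚ → ℚ
  half ε = ½ ℚ.* ε

  half-pos : ∀ {ε} → 0ℚ ℚ.< ε → 0ℚ ℚ.< half ε
  half-pos {ε} p = subst (ℚ._< half ε) (ℚₚ.*-zeroʳ ½) (ℚₚ.*-monoʳ-<-pos ½ p)

  half+half : ∀ ε → half ε ℚ.+ half ε ≡ ε
  half+half ε = trans (sym (ℚₚ.*-distribʳ-+ ε ½ ½)) (ℚₚ.*-identityˡ ε)

  ∣p-p∣≡0 : ∀ p → ∣ p ℚ.- p ∣ ≡ 0ℚ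
  ∣p-p∣≡0 p = cong ∣_∣ (ℚₚ.+-inverseʳ p)

  ∣p-q∣≡∣q-p∣ : ∀ p q → ∣ p ℚ.- q ∣ ≡ ∣ q ℚ.- p ∣
  ∣p-q∣≡∣q-p∣ p q = trans (sym (ℚₚ.∣-p∣≡∣p∣ (p ℚ.- q)))
    (cong ∣_∣ (neg-sub p q))

  triangle : ∀ p q r {ε} → ∣ p ℚ.- q ∣ ℚ.< half ε → ∣ q ℚ.- r ∣ ℚ.< half ε →
             ∣ p ℚ.- r ∣ ℚ.< ε
  triangle p q r {ε} u v = begin-strict
    ∣ p ℚ.- r ∣
      ≡⟨ cong ∣_∣ (telescope p q r) ⟩
    ∣ (p ℚ.- q) ℚ.+ (q ℚ.- r) ∣    ≤⟨ ℚₚ.∣p+q∣≤∣p∣+∣q∣ (p ℚ.- q) (q ℚ.- r) ⟩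
    ∣ p ℚ.- q ∣ ℚ.+ ∣ q ℚ.- r ∣    <⟨ ℚₚ.+-mono-< u v ⟩
    half ε ℚ.+ half ε              ≡⟨ half+half ε ⟩
    ε                              ∎
    where open ℚₚ.≤-Reasoning

  +-close : ∀ p q r s {ε} → ∣ p ℚ.- r ∣ ℚ.< half ε → ∣ q ℚ.- s ∣ ℚ.< half ε →
            ∣ (p ℚ.+ q) ℚ.- (r ℚ.+ s) ∣ ℚ.< ε
  +-close p q r s {ε} u v = begin-strict
    ∣ (p ℚ.+ q) ℚ.- (r ℚ.+ s) ∣
      ≡⟨ cong ∣_∣ (sum-sub p q r s) ⟩
    ∣ (p ℚ.- r) ℚ.+ (q ℚ.- s) ∣    ≤⟨ ℚₚ.∣p+q∣≤∣p∣+∣q∣ (p ℚ.- r) (q ℚ.- s) ⟩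
    ∣ p ℚ.- r ∣ ℚ.+ ∣ q ℚ.- s ∣    <⟨ ℚₚ.+-mono-< u v ⟩
    half ε ℚ.+ half ε              ≡⟨ half+half ε ⟩
    ε                              ∎
    where open ℚₚ.≤-Reasoning

  neg-close : ∀ p q → ∣ (ℚ.- p) ℚ.- (ℚ.- q) ∣ ≡ ∣ p ℚ.- q ∣
  neg-close p q = trans
    (cong ∣_∣ (sub-neg p q))
    (∣p-q∣≡∣q-p∣ q p)

  infixl 7 _÷_
  _÷_ : ℚ → (B : ℚ) → .{{ℚ.Positive B}} → ℚ
  ε ÷ B = (ℚ.1/ B) {{ℚₚ.pos⇒nonZero B}} ℚ.* ε

  ÷-pos : ∀ {ε} B .{{_ : ℚ.Positive B}} → 0ℚ ℚ.< ε → 0ℚ ℚ.< ε ÷ B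
  ÷-pos {ε} B p = subst (ℚ._< ε ÷ B) (ℚₚ.*-zeroʳ ((ℚ.1/ B) {{ℚₚ.pos⇒nonZero B}}))
    (ℚₚ.*-monoʳ-<-pos ((ℚ.1/ B) {{ℚₚ.pos⇒nonZero B}}) {{ℚₚ.1/pos⇒pos B}} p)

  *-÷ : ∀ ε B .{{_ : ℚ.Positive B}} → B ℚ.* (ε ÷ B) ≡ ε
  *-÷ ε B = trans (sym (ℚₚ.*-assoc B _ ε))
    (trans (cong (ℚ._* ε) (ℚₚ.*-inverseʳ B {{ℚₚ.pos⇒nonZero B}})) (ℚₚ.*-identityˡ ε))

  scale : ∀ a e B {δ} .{{_ : ℚ.Positive B}} → ∣ a ∣ ℚ.< B → ∣ e ∣ ℚ.< δ ÷ B →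
          ∣ a ℚ.* e ∣ ℚ.< δ
  scale a e B {δ} u v = begin-strict
    ∣ a ℚ.* e ∣        ≡⟨ ℚₚ.∣p*q∣≡∣p∣*∣q∣ a e ⟩
    ∣ a ∣ ℚ.* ∣ e ∣    ≤⟨ ℚₚ.*-monoʳ-≤-nonNeg ∣ e ∣ {{ℚₚ.∣-∣-nonNeg e}} (ℚₚ.<⇒≤ u) ⟩
    B ℚ.* ∣ e ∣        <⟨ ℚₚ.*-monoʳ-<-pos B v ⟩
    B ℚ.* (δ ÷ B)      ≡⟨ *-÷ δ B ⟩
    δ                  ∎
    where open ℚₚ.≤-Reasoning

  *-close : ∀ p q r s A D {ε} .{{_ : ℚ.Positive A}} .{{_ : ℚ.Positive D}} →
            ∣ p ∣ ℚ.< A → ∣ s ∣ ℚ.< D →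
            ∣ p ℚ.- r ∣ ℚ.< half ε ÷ D → ∣ q ℚ.- s ∣ ℚ.< half ε ÷ A →
            ∣ (p ℚ.* q) ℚ.- (r ℚ.* s) ∣ ℚ.< ε
  *-close p q r s A D {ε} pA sD u v = begin-strict
    ∣ (p ℚ.* q) ℚ.- (r ℚ.* s) ∣
      ≡⟨ cong ∣_∣ (prod-sub p q r s) ⟩
    ∣ p ℚ.* (q ℚ.- s) ℚ.+ s ℚ.* (p ℚ.- r) ∣
      ≤⟨ ℚₚ.∣p+q∣≤∣p∣+∣q∣ (p ℚ.* (q ℚ.- s)) (s ℚ.* (p ℚ.- r)) ⟩
    ∣ p ℚ.* (q ℚ.- s) ∣ ℚ.+ ∣ s ℚ.* (p ℚ.- r) ∣
      <⟨ ℚₚ.+-mono-< (scale p (q ℚ.- s) A pA v) (scale s (p ℚ.- r) D sD u) ⟩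
    half ε ℚ.+ half ε
      ≡⟨ half+half ε ⟩
    ε ∎
    where open ℚₚ.≤-Reasoning

  bounded : (x : ℝ) →
    ∃[ B ] ℚ.Positive B × ∃[ N ] (∀ n → N ℕ.≤ n → ∣ seq x n ∣ ℚ.< B)
  bounded x with cauchy x 1ℚ (ℚₚ.positive⁻¹ 1ℚ)
  ... | N , h = B , ℚ.positive B-pos , N , bound
    where
    a = seq x N
    B = 1ℚ ℚ.+ ∣ a ∣
    B-pos : 0ℚ ℚ.< B
    B-pos = ℚₚ.+-mono-<-≤ (ℚₚ.positive⁻¹ 1ℚ) (ℚₚ.0≤∣p∣ a)
    bound : ∀ n → N ℕ.≤ n → ∣ seq x n ∣ ℚ.< B
    bound n N≤n = begin-strict
      ∣ seq x n ∣
        ≡⟨ cong ∣_∣ (sub-add (seq x n) a) ⟩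
      ∣ (seq x n ℚ.- a) ℚ.+ a ∣       ≤⟨ ℚₚ.∣p+q∣≤∣p∣+∣q∣ (seq x n ℚ.- a) a ⟩
      ∣ seq x n ℚ.- a ∣ ℚ.+ ∣ a ∣     <⟨ ℚₚ.+-monoˡ-< ∣ a ∣ (h n N N≤n ℕₚ.≤-refl) ⟩
      1ℚ ℚ.+ ∣ a ∣                    ∎
      where open ℚₚ.≤-Reasoning

  ⊔ˡ : ∀ {M N n} → M ℕ.⊔ N ℕ.≤ n → M ℕ.≤ n
  ⊔ˡ {M} {N} = ℕₚ.≤-trans (ℕₚ.m≤m⊔n M N)

  ⊔ʳ : ∀ {M N n} → M ℕ.⊔ N ℕ.≤ n → N ℕ.≤ n
  ⊔ʳ {M} {N} = ℕₚ.≤-trans (ℕₚ.m≤n⊔m M N)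

  abstract
    const-cauchy : ∀ q → Cauchy (λ _ → q)
    const-cauchy q ε ε>0 =
      0 , λ _ _ _ _ → subst (ℚ._< ε) (sym (∣p-p∣≡0 q)) ε>0

    +-cauchy : ∀ x y → Cauchy (λ n → seq x n ℚ.+ seq y n)
    +-cauchy x y ε ε>0 with cauchy x (half ε) (half-pos ε>0) | cauchy y (half ε) (half-pos ε>0)
    ... | M , f | N , g = M ℕ.⊔ N , λ m n p q →
      +-close (seq x m) (seq y m) (seq x n) (seq y n)
        (f m n (⊔ˡ {M} p) (⊔ˡ {M} q)) (g m n (⊔ʳ {M} p) (⊔ʳ {M} q))

    neg-cauchy : ∀ x → Cauchy (λ n → ℚ.- seq x n)
    neg-cauchy x ε ε>0 with cauchy x ε ε>0
    ... | N , f = N , λ m n p q →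
      subst (ℚ._< ε) (sym (neg-close (seq x m) (seq x n))) (f m n p q)

    *-cauchy : ∀ x y → Cauchy (λ n → seq x n ℚ.* seq y n)
    *-cauchy x y ε ε>0 =
      let (A , A>0 , K , k) = bounded x
          (D , D>0 , L , l) = bounded y
          (M , f) = cauchy x (_÷_ (half ε) D {{D>0}}) (÷-pos D {{D>0}} (half-pos ε>0))
          (N , g) = cauchy y (_÷_ (half ε) A {{A>0}}) (÷-pos A {{A>0}} (half-pos ε>0))
      in (K ℕ.⊔ L) ℕ.⊔ (M ℕ.⊔ N) , λ m n p q →
      let p₁ = ⊔ˡ {K ℕ.⊔ L} p ; p₂ = ⊔ʳ {K ℕ.⊔ L} p
          q₁ = ⊔ˡ {K ℕ.⊔ L} q ; q₂ = ⊔ʳ {K ℕ.⊔ L} q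
      in *-close (seq x m) (seq y m) (seq x n) (seq y n) A D {{A>0}} {{D>0}}
           (k m (⊔ˡ {K} p₁)) (l n (⊔ʳ {K} q₁))
           (f m n (⊔ˡ {M} p₂) (⊔ˡ {M} q₂)) (g m n (⊔ʳ {M} p₂) (⊔ʳ {M} q₂))

infixl 6 _+ℝ_
infixl 7 _*ℝ_
infix  8 -ℝ_

fromℚ : ℚ → ℝ
fromℚ q = mkℝ (λ _ → q) (const-cauchy q)

0ℝ 1ℝ : ℝ
0ℝ = fromℚ 0ℚ
1ℝ = fromℚ 1ℚ

_+ℝ_ : ℝ → ℝ → ℝ
x +ℝ y = mkℝ (λ n → seq x n ℚ.+ seq y n) (+-cauchy x y)

-ℝ_ : ℝ → ℝ
-ℝ x = mkℝ (λ n → ℚ.- seq x n) (neg-cauchy x)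

_*ℝ_ : ℝ → ℝ → ℝ
x *ℝ y = mkℝ (λ n → seq x n ℚ.* seq y n) (*-cauchy x y)

private
  pointwise : ∀ {x y} → (∀ n → seq x n ≡ seq y n) → x ≈ y
  pointwise {x} {y} h = mk≈ λ ε ε>0 → 0 , λ n _ →
    subst (ℚ._< ε)
      (sym (trans (cong (λ z → ∣ z ℚ.- seq y n ∣) (h n)) (∣p-p∣≡0 (seq y n)))) ε>0

  ≈-sym : ∀ {x y} → x ≈ y → y ≈ x
  ≈-sym {x} {y} (mk≈ h) = mk≈ λ ε ε>0 → let (N , f) = h ε ε>0 in
    N , λ n p → subst (ℚ._< ε) (∣p-q∣≡∣q-p∣ (seq x n) (seq y n)) (f n p)

  ≈-trans : ∀ {x y z} → x ≈ y → y ≈ z → x ≈ z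
  ≈-trans {x} {y} {z} (mk≈ h) (mk≈ k) = mk≈ λ ε ε>0 →
    let (M , f) = h (half ε) (half-pos ε>0)
        (N , g) = k (half ε) (half-pos ε>0)
    in M ℕ.⊔ N , λ n p →
         triangle (seq x n) (seq y n) (seq z n) (f n (⊔ˡ p)) (g n (⊔ʳ {M} p))

  +ℝ-cong : ∀ {x y u v} → x ≈ y → u ≈ v → (x +ℝ u) ≈ (y +ℝ v)
  +ℝ-cong {x} {y} {u} {v} (mk≈ h) (mk≈ k) = mk≈ λ ε ε>0 →
    let (M , f) = h (half ε) (half-pos ε>0)
        (N , g) = k (half ε) (half-pos ε>0)
    in M ℕ.⊔ N , λ n p →
         +-close (seq x n) (seq u n) (seq y n) (seq v n) (f n (⊔ˡ p)) (g n (⊔ʳ {M} p))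

  -ℝ-cong : ∀ {x y} → x ≈ y → (-ℝ x) ≈ (-ℝ y)
  -ℝ-cong {x} {y} (mk≈ h) = mk≈ λ ε ε>0 → let (N , f) = h ε ε>0 in
    N , λ n p → subst (ℚ._< ε) (sym (neg-close (seq x n) (seq y n))) (f n p)

  *ℝ-cong : ∀ {x y u v} → x ≈ y → u ≈ v → (x *ℝ u) ≈ (y *ℝ v)
  *ℝ-cong {x} {y} {u} {v} (mk≈ h) (mk≈ h′) = mk≈ λ ε ε>0 →
    let (A , A>0 , K , k) = bounded x
        (D , D>0 , L , l) = bounded v
        (M , f) = h  (_÷_ (half ε) D {{D>0}}) (÷-pos D {{D>0}} (half-pos ε>0))
        (N , g) = h′ (_÷_ (half ε) A {{A>0}}) (÷-pos A {{A>0}} (half-pos ε>0))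
    in (K ℕ.⊔ L) ℕ.⊔ (M ℕ.⊔ N) , λ n p →
      let p₁ = ⊔ˡ {K ℕ.⊔ L} p ; p₂ = ⊔ʳ {K ℕ.⊔ L} p
      in *-close (seq x n) (seq u n) (seq y n) (seq v n) A D {{A>0}} {{D>0}}
           (k n (⊔ˡ {K} p₁)) (l n (⊔ʳ {K} p₁)) (f n (⊔ˡ {M} p₂)) (g n (⊔ʳ {M} p₂))

ℝ-isCommutativeRing : IsCommutativeRing _≈_ _+ℝ_ _*ℝ_ -ℝ_ 0ℝ 1ℝ
ℝ-isCommutativeRing = record
  { isRing = record
    { +-isAbelianGroup = record
      { isGroup = record
        { isMonoid = record
          { isSemigroup = record
            { isMagma = record
              { isEquivalence = record
                { refl = pointwise λ _ → refl ; sym = ≈-sym ; trans = ≈-trans }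
              ; ∙-cong = +ℝ-cong }
            ; assoc = λ x y z → pointwise λ n → ℚₚ.+-assoc (seq x n) (seq y n) (seq z n) }
          ; identity = (λ x → pointwise λ n → ℚₚ.+-identityˡ (seq x n))
                     , (λ x → pointwise λ n → ℚₚ.+-identityʳ (seq x n)) }
        ; inverse = (λ x → pointwise λ n → ℚₚ.+-inverseˡ (seq x n))
                  , (λ x → pointwise λ n → ℚₚ.+-inverseʳ (seq x n))
        ; ⁻¹-cong = -ℝ-cong }
      ; comm = λ x y → pointwise λ n → ℚₚ.+-comm (seq x n) (seq y n) }
    ; *-cong = *ℝ-cong
    ; *-assoc = λ x y z → pointwise λ n → ℚₚ.*-assoc (seq x n) (seq y n) (seq z n)
    ; *-identity = (λ x → pointwise λ n → ℚₚ.*-identityˡ (seq x n))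
                 , (λ x → pointwise λ n → ℚₚ.*-identityʳ (seq x n))
    ; distrib = (λ x y z → pointwise λ n → ℚₚ.*-distribˡ-+ (seq x n) (seq y n) (seq z n))
              , (λ x y z → pointwise λ n → ℚₚ.*-distribʳ-+ (seq x n) (seq y n) (seq z n)) }
  ; *-comm = λ x y → pointwise λ n → ℚₚ.*-comm (seq x n) (seq y n) }

ℝ-commutativeRing : CommutativeRing 0ℓ 0ℓ
ℝ-commutativeRing = record { isCommutativeRing = ℝ-isCommutativeRing }

------------------------------------------------------------------------
-- Rank over ℝ

open import Algebra.Properties.Monoid.Sum
  (CommutativeRing.+-monoid ℝ-commutativeRing) public using (sum)

Matrix : Set → Set → Set
Matrix I J = I → J → ℝ

LinearlyIndependent : ∀ {J : Set} {k} → (Fin k → J → ℝ) → Set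
LinearlyIndependent {J} {k} v = (c : Fin k → ℝ) →
  (∀ j → sum (λ i → c i *ℝ v i j) ≈ 0ℝ) → ∀ i → c i ≈ 0ℝ

-- The rank as the maximal number of linearly independent rows.  Families
-- of rows may list a row twice, but then they are not independent.
record IsRank {I J : Set} (M : Matrix I J) (r : ℕ) : Set where
  field
    independentRows : Σ (Fin r → I) λ rows → LinearlyIndependent (λ i → M (rows i))
    maximal         : ∀ k (rows : Fin k → I) →
                      LinearlyIndependent (λ i → M (rows i)) → k ℕ.≤ r

------------------------------------------------------------------------
-- Deterministic two-party communication

-- At an internal node the named player sends one bit computed from their
-- own input, and the protocol continues in the first subtree on true and
-- in the second on false.  A leaf carries the output, which is thus
-- determined by the transcript alone.
data Protocol (X Y Z : Set) : Set where
  output : Z → Protocol X Y Z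
  alice  : (X → Bool) → Protocol X Y Z → Protocol X Y Z → Protocol X Y Z
  bob    : (Y → Bool) → Protocol X Y Z → Protocol X Y Z → Protocol X Y Z

module _ {X Y Z : Set} where

  run : Protocol X Y Z → X → Y → Z
  run (output z)    x y = z
  run (alice a P Q) x y = if a x then run P x y else run Q x y
  run (bob b P Q)   x y = if b y then run P x y else run Q x y

  cost : Protocol X Y Z → ℕ
  cost (output _)    = 0
  cost (alice _ P Q) = suc (cost P ℕ.⊔ cost Q)
  cost (bob _ P Q)   = suc (cost P ℕ.⊔ cost Q)

  Computes : Protocol X Y Z → (X → Y → Z) → Set
  Computes P f = ∀ x y → run P x y ≡ f x y

  record IsCommunicationComplexity (f : X → Y → Z) (d : ℕ) : Set where
    field
      attained : ∃[ P ] Computes P f × cost P ≡ d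
      minimal  : ∀ P → Computes P f → d ℕ.≤ cost P

------------------------------------------------------------------------
-- Permutation-invariant functions

-- Sign plays the role of {-1, 1}.
BoolFun₂ : ℕ → Set
BoolFun₂ n = Vec Bool n → Vec Bool n → Sign

permute : ∀ {n} → Vec Bool n → Permutation′ n → Vec Bool n
permute x π = tabulate (λ i → lookup x (π ⟨$⟩ʳ i))

weight : ∀ {n} → Vec Bool n → ℕ
weight = count (_≟ᵇ true)

PermutationInvariant : ∀ {n} → BoolFun₂ n → Set
PermutationInvariant f = ∀ x y π → f (permute x π) (permute y π) ≡ f x y

DependsOnlyOnWeights : ∀ {n} → BoolFun₂ n → Set
DependsOnlyOnWeights f = ∀ x y x′ y′ →
  weight x ≡ weight x′ → weight y ≡ weight y′ → f x y ≡ f x′ y′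

NonTrivial : ∀ {n} → BoolFun₂ n → Set
NonTrivial f = ¬ DependsOnlyOnWeights f

signToℝ : Sign → ℝ
signToℝ Sign.+ = 1ℝ
signToℝ Sign.- = -ℝ 1ℝ

inputMatrix : ∀ {n} → BoolFun₂ n → Matrix (Vec Bool n) (Vec Bool n)
inputMatrix f x y = signToℝ (f x y)

{-# OPTIONS --safe #-}
-- f x y depends only on how often the pairs 11, 10, 01, 00 occur among the
-- (xᵢ , yᵢ).  Let m bound min(v, n − v) for one of the two weights v in every pair
-- of weights that does not determine f.  The players announce their weights; then
-- one of them sends the input as an index into a list of at most 2 (n + 1)^m vectors,
-- unless the weights determine f.  So D(f) = O(m log n), and it remains to bound
-- m and log n by O(log rank(f)).
--
-- Fix the weights and let p k be the value of f at intersection size k.  Take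
-- j blocks of q + 1 coordinates and one-hot vectors in each of them; in one
-- block, the difference of two columns is supported on a single one of q rows.
-- Taking the product over the blocks gives q^j rows that are independent as
-- soon as the j-th difference of p is nonzero somewhere.
--   * With j = 1 and q large this gives rank ≥ (n + 2) / 4.
--   * With q = 2 and j = 2^k it gives rank ≥ 2^j: if the j-th difference vanished
--     on a window of length 2 j, then (p + 1) / 2 would be a 0-1-valued polynomial of
--     degree < j that has period j modulo 2, hence has period j, hence is constant.
module Submission where

open import Algebra.Bundles using (AbelianGroup; CommutativeRing)
import Algebra.Properties.CommutativeMonoid.Sum as MonoidSum
import Algebra.Properties.Group as GroupProperties
import Algebra.Properties.Ring as RingProperties
open import Data.Bool using (Bool; true; false; not; if_then_else_)
open import Data.Bool.Properties using (not-involutive) renaming (_≟_ to _≟ᵇ_)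
open import Data.Fin using (Fin; zero; suc; remQuot; combine) renaming (_≟_ to _≟ᶠ_)
open import Data.Fin.Permutation using (Permutation′; _⟨$⟩ʳ_; lift₀; swap; _∘ₚ_) renaming (id to idₚ)
open import Data.Fin.Properties using (combine-remQuot) renaming (suc-injective to Fin-suc-injective)
open import Data.Integer as ℤ using (ℤ; 0ℤ; 1ℤ) renaming (+_ to pos)
import Data.Integer.Properties as ℤₚ
import Data.Integer.Tactic.RingSolver as ℤ-Solver
open import Data.List as List using (List; []; _∷_; length)
open import Data.List.Membership.Propositional using (_∈_)
open import Data.List.Membership.Propositional.Properties using (∈-map⁺; ∈-++⁺ˡ; ∈-++⁺ʳ)
open import Data.List.Properties using (length-map; length-++)
open import Data.List.Relation.Unary.Any using (here; there)
open import Data.Nat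
  using (ℕ; zero; suc; _+_; _*_; _^_; _∸_; _⊓_; _⊔_; _≤_; _<_; z≤n; s≤s; _<?_)
open import Data.Nat.Logarithm using (⌊log₂_⌋; ⌊log₂⌋-mono-≤; ⌊log₂[2^n]⌋≡n)
open import Data.Nat.Properties hiding (_≟_)
import Data.Nat.Tactic.RingSolver as ℕ-Solver
open import Data.Product using (∃-syntax; _×_; _,_; proj₁; proj₂; uncurry)
open import Data.Rational as ℚ using (ℚ)
import Data.Rational.Properties as ℚₚ
import Data.Rational.Unnormalised as ℚᵘ
import Data.Rational.Unnormalised.Properties as ℚᵘₚ
open import Data.Sign using (Sign)
import Data.Sign.Properties as Signₚ
open import Data.Sum using (_⊎_; inj₁; inj₂)
open import Data.Vec using (Vec; []; _∷_; _++_; head; tail; lookup; map; replicate)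
open import Data.Vec.Properties
  using (≡-dec; map-∘; map-id; map-cong; tabulate∘lookup; tabulate-cong)
open import Function using (_∘_)
open import Relation.Binary.Definitions using (DecidableEquality)
open import Relation.Binary.PropositionalEquality hiding (resp)
import Relation.Binary.Reasoning.Setoid as SetoidReasoning
open import Relation.Nullary using (¬_; Dec; yes; no; does; contradiction)
open import Relation.Nullary.Decidable using (decidable-stable; _⊎-dec_)
open import Defs

-- Permutation invariance and profiles

-- Profile x y a b c d: the pairs (xᵢ , yᵢ) take the values 11, 10, 01, 00
-- exactly a, b, c, d times.
data Profile : ∀ {n} → Vec Bool n → Vec Bool n → ℕ → ℕ → ℕ → ℕ → Set where
  []  : Profile [] [] 0 0 0 0
  11∷ : ∀ {n} {x y : Vec Bool n} {a b c d} →
        Profile x y a b c d → Profile (true ∷ x) (true ∷ y) (suc a) b c d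
  10∷ : ∀ {n} {x y : Vec Bool n} {a b c d} →
        Profile x y a b c d → Profile (true ∷ x) (false ∷ y) a (suc b) c d
  01∷ : ∀ {n} {x y : Vec Bool n} {a b c d} →
        Profile x y a b c d → Profile (false ∷ x) (true ∷ y) a b (suc c) d
  00∷ : ∀ {n} {x y : Vec Bool n} {a b c d} →
        Profile x y a b c d → Profile (false ∷ x) (false ∷ y) a b c (suc d)

profile : ∀ {n} (x y : Vec Bool n) →
  ∃[ a ] ∃[ b ] ∃[ c ] ∃[ d ] Profile x y a b c d
profile [] [] = _ , _ , _ , _ , []
profile (true  ∷ x) (true  ∷ y) with profile x y
... | _ , _ , _ , _ , P = _ , _ , _ , _ , 11∷ P
profile (true  ∷ x) (false ∷ y) with profile x y
... | _ , _ , _ , _ , P = _ , _ , _ , _ , 10∷ P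
profile (false ∷ x) (true  ∷ y) with profile x y
... | _ , _ , _ , _ , P = _ , _ , _ , _ , 01∷ P
profile (false ∷ x) (false ∷ y) with profile x y
... | _ , _ , _ , _ , P = _ , _ , _ , _ , 00∷ P

module _ where
  private variable
    n a b c d : ℕ
    x y : Vec Bool n

  profile-length : Profile {n} x y a b c d → n ≡ (a + b) + (c + d)
  profile-length [] = refl
  profile-length (11∷ P) = cong suc (profile-length P)
  profile-length {a = a} {c = c} {d} (10∷ {b = b} P) =
    trans (cong suc (profile-length P)) (cong (_+ (c + d)) (sym (+-suc a b)))
  profile-length {a = a} {b} (01∷ P) = trans (cong suc (profile-length P)) (sym (+-suc (a + b) _))
  profile-length {a = a} {b} {c} (00∷ {d = d} P) =
    trans (cong suc (profile-length P)) (trans (sym (+-suc (a + b) _)) (cong (a + b +_) (sym (+-suc c d))))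

  profile-weightˡ : Profile x y a b c d → weight x ≡ a + b
  profile-weightˡ [] = refl
  profile-weightˡ (11∷ P) = cong suc (profile-weightˡ P)
  profile-weightˡ {a = a} (10∷ P) = trans (cong suc (profile-weightˡ P)) (sym (+-suc a _))
  profile-weightˡ (01∷ P) = profile-weightˡ P
  profile-weightˡ (00∷ P) = profile-weightˡ P

  profile-swap : Profile x y a b c d → Profile y x a c b d
  profile-swap [] = []
  profile-swap (11∷ P) = 11∷ (profile-swap P)
  profile-swap (10∷ P) = 01∷ (profile-swap P)
  profile-swap (01∷ P) = 10∷ (profile-swap P)
  profile-swap (00∷ P) = 00∷ (profile-swap P)

  profile-weightʳ : Profile x y a b c d → weight y ≡ a + c
  profile-weightʳ P = profile-weightˡ (profile-swap P)

  profile-notʳ : Profile x y a b c d → Profile x (map not y) b a d c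
  profile-notʳ [] = []
  profile-notʳ (11∷ P) = 10∷ (profile-notʳ P)
  profile-notʳ (10∷ P) = 11∷ (profile-notʳ P)
  profile-notʳ (01∷ P) = 00∷ (profile-notʳ P)
  profile-notʳ (00∷ P) = 01∷ (profile-notʳ P)

  profile-notˡ : Profile x y a b c d → Profile (map not x) y c d a b
  profile-notˡ P = profile-swap (profile-notʳ (profile-swap P))

  profile-d-unique : ∀ {n a b c d d′} {x y x′ y′ : Vec Bool n} →
    Profile x y a b c d → Profile x′ y′ a b c d′ → d ≡ d′
  profile-d-unique {a = a} {b} {c} P Q =
    +-cancelˡ-≡ c _ _ (+-cancelˡ-≡ (a + b) _ _ (trans (sym (profile-length P)) (profile-length Q)))

-- The pairs 00 fill whatever remains of the length `n`; counts that do not fit are cut off.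
canonical : ∀ n (a b c : ℕ) → Vec Bool n × Vec Bool n
canonical zero    _       _       _       = [] , []
canonical (suc n) (suc a) b       c       = let (x , y) = canonical n a b c in true ∷ x , true ∷ y
canonical (suc n) zero    (suc b) c       = let (x , y) = canonical n 0 b c in true ∷ x , false ∷ y
canonical (suc n) zero    zero    (suc c) = let (x , y) = canonical n 0 0 c in false ∷ x , true ∷ y
canonical (suc n) zero    zero    zero    = let (x , y) = canonical n 0 0 0 in false ∷ x , false ∷ y

canonical-profile : ∀ n {a b c d} → n ≡ (a + b) + (c + d) →
  let (x , y) = canonical n a b c in Profile x y a b c d
canonical-profile zero    {zero} {zero} {zero} {zero} _ = []
canonical-profile (suc n) {suc a} e = 11∷ (canonical-profile n (suc-injective e))
canonical-profile (suc n) {zero} {suc b} e = 10∷ (canonical-profile n (suc-injective e))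
canonical-profile (suc n) {zero} {zero} {suc c} e = 01∷ (canonical-profile n (suc-injective e))
canonical-profile (suc n) {zero} {zero} {zero} {suc d} e = 00∷ (canonical-profile n (suc-injective e))

-- Sorting a pair of vectors into canonical order

record Rearrangement {n} (p q : Vec Bool n × Vec Bool n) : Set where
  constructor rearr
  field
    perm : Permutation′ n
    fst≗ : ∀ i → lookup (proj₁ q) i ≡ lookup (proj₁ p) (perm ⟨$⟩ʳ i)
    snd≗ : ∀ i → lookup (proj₂ q) i ≡ lookup (proj₂ p) (perm ⟨$⟩ʳ i)

infixr 5 _∷²_
_∷²_ : ∀ {n} → Bool × Bool → Vec Bool n × Vec Bool n → Vec Bool (suc n) × Vec Bool (suc n)
(s , t) ∷² (x , y) = s ∷ x , t ∷ y

private variable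
  n : ℕ
  xy xy′ xy″ : Vec Bool n × Vec Bool n

rearr-refl : Rearrangement xy xy
rearr-refl = rearr idₚ (λ _ → refl) (λ _ → refl)

rearr-trans : Rearrangement xy xy′ → Rearrangement xy′ xy″ → Rearrangement xy xy″
rearr-trans (rearr π f g) (rearr ρ h k) =
  rearr (ρ ∘ₚ π) (λ i → trans (h i) (f _)) (λ i → trans (k i) (g _))

rearr-prep : ∀ s → Rearrangement xy xy′ → Rearrangement (s ∷² xy) (s ∷² xy′)
rearr-prep s (rearr π f g) =
  rearr (lift₀ π) (λ { zero → refl ; (suc i) → f i }) (λ { zero → refl ; (suc i) → g i })

rearr-swap : ∀ {xy : Vec Bool n × Vec Bool n} s t → Rearrangement (s ∷² t ∷² xy) (t ∷² s ∷² xy)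
rearr-swap s t = rearr (swap idₚ)
  (λ { zero → refl ; (suc zero) → refl ; (suc (suc i)) → refl })
  (λ { zero → refl ; (suc zero) → refl ; (suc (suc i)) → refl })

rearr-insert : ∀ s {t} → Rearrangement (s ∷² xy) xy′ → Rearrangement (s ∷² t ∷² xy) (t ∷² xy′)
rearr-insert s {t} R = rearr-trans (rearr-swap s t) (rearr-prep t R)

-- The bound keeps `canonical` from cutting off a count, so the new pair finds its place behind the
-- pairs 11.
insert-10 : ∀ n a b c → a + b + c ≤ n →
  Rearrangement ((true , false) ∷² canonical n a b c) (canonical (suc n) a (suc b) c)
insert-10 n zero b c le = rearr-refl
insert-10 (suc n) (suc a) b c (s≤s le) = rearr-insert _ (insert-10 n a b c le)

insert-01 : ∀ n a b c → a + b + c ≤ n →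
  Rearrangement ((false , true) ∷² canonical n a b c) (canonical (suc n) a b (suc c))
insert-01 n zero zero c le = rearr-refl
insert-01 (suc n) zero (suc b) c (s≤s le) = rearr-insert _ (insert-01 n zero b c le)
insert-01 (suc n) (suc a) b c (s≤s le) = rearr-insert _ (insert-01 n a b c le)

insert-00 : ∀ n a b c → a + b + c ≤ n →
  Rearrangement ((false , false) ∷² canonical n a b c) (canonical (suc n) a b c)
insert-00 n zero zero zero le = rearr-refl
insert-00 (suc n) zero zero (suc c) (s≤s le) = rearr-insert _ (insert-00 n zero zero c le)
insert-00 (suc n) zero (suc b) c (s≤s le) = rearr-insert _ (insert-00 n zero b c le)
insert-00 (suc n) (suc a) b c (s≤s le) = rearr-insert _ (insert-00 n a b c le)

profile-abc≤n : ∀ {a b c d} {x y : Vec Bool n} → Profile x y a b c d → a + b + c ≤ n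
profile-abc≤n {a = a} {b} {c} {d} P =
  ≤-trans (+-monoʳ-≤ (a + b) (m≤m+n c d)) (≤-reflexive (sym (profile-length P)))

-- Insertion sort: the tail is sorted first, then the head pair moves behind the pairs that precede
-- it in the order 11, 10, 01, 00.
rearr-canonical : ∀ {a b c d} {x y : Vec Bool n} → Profile x y a b c d →
  Rearrangement (x , y) (canonical n a b c)
rearr-canonical [] = rearr-refl
rearr-canonical (11∷ P) = rearr-prep _ (rearr-canonical P)
rearr-canonical (10∷ P) =
  rearr-trans (rearr-prep _ (rearr-canonical P)) (insert-10 _ _ _ _ (profile-abc≤n P))
rearr-canonical (01∷ P) =
  rearr-trans (rearr-prep _ (rearr-canonical P)) (insert-01 _ _ _ _ (profile-abc≤n P))
rearr-canonical (00∷ P) =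
  rearr-trans (rearr-prep _ (rearr-canonical P)) (insert-00 _ _ _ _ (profile-abc≤n P))

-- The length forces `d` and `d′` to agree; keeping them apart spares each use that computation.
ProfileInvariant : BoolFun₂ n → Set
ProfileInvariant {n} f = ∀ {a b c d d′} {x y x′ y′ : Vec Bool n} →
  Profile x y a b c d → Profile x′ y′ a b c d′ → f x y ≡ f x′ y′

permute-lookup : (π : Permutation′ n) (x : Vec Bool n) {x′ : Vec Bool n} →
  (∀ i → lookup x′ i ≡ lookup x (π ⟨$⟩ʳ i)) → permute x π ≡ x′
permute-lookup π x h = trans (sym (tabulate-cong h)) (tabulate∘lookup _)

-- Both arguments are rearrangements of the same canonical pair, since `canonical` does not mention
-- `d`.
profileInvariant : {f : BoolFun₂ n} → PermutationInvariant f → ProfileInvariant f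
profileInvariant {n} {f} inv P Q = trans (canon P) (sym (canon Q))
  where
  canon : ∀ {a b c d} {x y : Vec Bool n} → Profile x y a b c d →
          let (x′ , y′) = canonical n a b c in f x y ≡ f x′ y′
  canon {x = x} {y} P with rearr-canonical P
  ... | rearr π g h = trans (sym (inv x y π)) (cong₂ f (permute-lookup π x g) (permute-lookup π y h))

-- Linear independence over ℝ

module ℝ-ring = CommutativeRing ℝ-commutativeRing
module ℝ-props = RingProperties ℝ-ring.ring
module ℝ-sum = MonoidSum ℝ-ring.+-commutativeMonoid
module ℝ-Reasoning = SetoidReasoning ℝ-ring.setoid

≈-reflexive : ∀ {x y} → x ≡ y → x ≈ y
≈-reflexive refl = ℝ-ring.refl

≈-pointwise : ∀ {x y} → (∀ n → seq x n ≡ seq y n) → x ≈ y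
≈-pointwise {x} {y} h = mk≈ λ ε ε>0 → 0 , λ n _ →
  subst (ℚ._< ε)
    (sym (trans (cong (λ z → ℚ.∣ z ℚ.- seq y n ∣) (h n)) (cong ℚ.∣_∣ (ℚₚ.+-inverseʳ (seq y n))))) ε>0

ℤ→ℚ : ℤ → ℚ
ℤ→ℚ z = z ℚ./ 1

ℤ→ℚ-homo-- : ∀ a b → ℤ→ℚ (a ℤ.- b) ≡ ℤ→ℚ a ℚ.- ℤ→ℚ b
ℤ→ℚ-homo-- a b = ℚₚ.toℚᵘ-injective (begin
  ℚ.toℚᵘ (ℤ→ℚ (a ℤ.- b))                              ≈⟨ ℚₚ.toℚᵘ-fromℚᵘ (emb (a ℤ.- b)) ⟩
  emb (a ℤ.- b)
    ≡⟨ cong₂ (λ s t → emb (s ℤ.+ t)) (ℤₚ.*-identityʳ a) (ℤₚ.*-identityʳ (ℤ.- b)) ⟨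
  emb a ℚᵘ.- emb b
    ≈⟨ ℚᵘₚ.+-cong (ℚₚ.toℚᵘ-fromℚᵘ (emb a)) (ℚᵘₚ.-‿cong (ℚₚ.toℚᵘ-fromℚᵘ (emb b))) ⟨
  ℚ.toℚᵘ (ℤ→ℚ a) ℚᵘ.- ℚ.toℚᵘ (ℤ→ℚ b)                  ≈⟨ ℚᵘₚ.+-congʳ (ℚ.toℚᵘ (ℤ→ℚ a)) (ℚₚ.toℚᵘ-homo‿- (ℤ→ℚ b)) ⟨
  ℚ.toℚᵘ (ℤ→ℚ a) ℚᵘ.+ ℚ.toℚᵘ (ℚ.- ℤ→ℚ b)              ≈⟨ ℚₚ.toℚᵘ-homo-+ (ℤ→ℚ a) (ℚ.- ℤ→ℚ b) ⟨
  ℚ.toℚᵘ (ℤ→ℚ a ℚ.- ℤ→ℚ b)                            ∎)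
  where
  open SetoidReasoning ℚᵘₚ.≃-setoid
  emb : ℤ → ℚᵘ.ℚᵘ
  emb z = ℚᵘ.mkℚᵘ z 0

ℤ→ℚ-injective : ∀ {a b} → ℤ→ℚ a ≡ ℤ→ℚ b → a ≡ b
ℤ→ℚ-injective {a} {b} e with ℚₚ.fromℚᵘ-injective {ℚᵘ.mkℚᵘ a 0} {ℚᵘ.mkℚᵘ b 0} e
... | ℚᵘ.*≡* h = trans (sym (ℤₚ.*-identityʳ a)) (trans h (ℤₚ.*-identityʳ b))

ℤ→ℝ : ℤ → ℝ
ℤ→ℝ z = fromℚ (ℤ→ℚ z)

ℤ→ℝ-homo-- : ∀ a b → ℤ→ℝ (a ℤ.- b) ≈ ℤ→ℝ a +ℝ -ℝ ℤ→ℝ b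
ℤ→ℝ-homo-- a b = ≈-pointwise λ _ → ℤ→ℚ-homo-- a b

-- The factor is an integer, so its inverse is a rational constant and can be multiplied in
-- directly.
*-ℤ→ℝ-cancel : ∀ x z → z ≢ 0ℤ → x *ℝ ℤ→ℝ z ≈ 0ℝ → x ≈ 0ℝ
*-ℤ→ℝ-cancel x z z≢0 h = begin
  x                                       ≈⟨ ℝ-ring.*-identityʳ x ⟨
  x *ℝ 1ℝ                                 ≈⟨ ℝ-ring.*-congˡ {x} (≈-pointwise λ _ → ℚₚ.*-inverseʳ q) ⟨
  x *ℝ (ℤ→ℝ z *ℝ fromℚ (ℚ.1/ q))          ≈⟨ ℝ-ring.*-assoc x (ℤ→ℝ z) _ ⟨
  x *ℝ ℤ→ℝ z *ℝ fromℚ (ℚ.1/ q)            ≈⟨ ℝ-ring.*-congʳ h ⟩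
  0ℝ *ℝ fromℚ (ℚ.1/ q)                    ≈⟨ ℝ-ring.zeroˡ (fromℚ (ℚ.1/ q)) ⟩
  0ℝ                                      ∎
  where
  open ℝ-Reasoning
  q = ℤ→ℚ z
  instance
    q≢0 : ℚ.NonZero q
    q≢0 = ℚ.≢-nonZero (λ e → z≢0 (ℤ→ℚ-injective e))

signToℤ : Sign → ℤ
signToℤ Sign.+ = 1ℤ
signToℤ Sign.- = ℤ.- 1ℤ

ℤ→ℝ-signToℤ : ∀ s → ℤ→ℝ (signToℤ s) ≈ signToℝ s
ℤ→ℝ-signToℤ Sign.+ = ≈-pointwise λ _ → refl
ℤ→ℝ-signToℤ Sign.- = ≈-pointwise λ _ → refl

-- Stands for the group of integer vectors annihilated by a coefficient vector. The field `respects`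
-- takes the place of function extensionality.
record Subtractive {U : Set} (N : (U → ℤ) → Set) : Set where
  field
    respects : ∀ {g h} → (∀ u → g u ≡ h u) → N g → N h
    subtract : ∀ {g h} → N g → N h → N (λ u → g u ℤ.- h u)

δ : ∀ {k} → Fin k → ℤ → Fin k → ℤ
δ i z i′ = if does (i ≟ᶠ i′) then z else 0ℤ

δ-diag : ∀ {k} (i : Fin k) z → δ i z i ≡ z
δ-diag i z with i ≟ᶠ i
... | yes _ = refl
... | no ne = contradiction refl ne

δ-suc : ∀ {k} (i : Fin k) z i′ → δ (suc i) z (suc i′) ≡ δ i z i′
δ-suc i z i′ with i ≟ᶠ i′
... | yes _ = refl
... | no _ = refl

combination : ∀ {k} → (Fin k → ℝ) → (Fin k → ℤ) → ℝ
combination c g = sum λ i → c i *ℝ ℤ→ℝ (g i)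

combination-zero : ∀ {k} (c : Fin k → ℝ) → combination c (λ _ → 0ℤ) ≈ 0ℝ
combination-zero {zero} c = ℝ-ring.refl
combination-zero {suc k} c = begin
  c zero *ℝ ℤ→ℝ 0ℤ +ℝ combination (c ∘ suc) (λ _ → 0ℤ)
    ≈⟨ ℝ-ring.+-cong (ℝ-ring.zeroʳ (c zero)) (combination-zero (c ∘ suc)) ⟩
  0ℝ +ℝ 0ℝ   ≈⟨ ℝ-ring.+-identityˡ 0ℝ ⟩
  0ℝ         ∎
  where open ℝ-Reasoning

combination-δ : ∀ {k} (c : Fin k → ℝ) i z → combination c (δ i z) ≈ c i *ℝ ℤ→ℝ z
combination-δ c zero z = begin
  c zero *ℝ ℤ→ℝ z +ℝ combination (c ∘ suc) (λ _ → 0ℤ)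
    ≈⟨ ℝ-ring.+-congˡ {c zero *ℝ ℤ→ℝ z} (combination-zero (c ∘ suc)) ⟩
  c zero *ℝ ℤ→ℝ z +ℝ 0ℝ     ≈⟨ ℝ-ring.+-identityʳ (c zero *ℝ ℤ→ℝ z) ⟩
  c zero *ℝ ℤ→ℝ z           ∎
  where open ℝ-Reasoning
combination-δ c (suc i) z = begin
  c zero *ℝ ℤ→ℝ 0ℤ +ℝ combination (c ∘ suc) (δ (suc i) z ∘ suc)
    ≈⟨ ℝ-ring.+-cong (ℝ-ring.zeroʳ (c zero))
         (≈-reflexive (ℝ-sum.sum-cong-≗ λ i′ → cong (λ w → c (suc i′) *ℝ ℤ→ℝ w) (δ-suc i z i′))) ⟩
  0ℝ +ℝ combination (c ∘ suc) (δ i z)     ≈⟨ ℝ-ring.+-identityˡ _ ⟩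
  combination (c ∘ suc) (δ i z)           ≈⟨ combination-δ (c ∘ suc) i z ⟩
  c (suc i) *ℝ ℤ→ℝ z                      ∎
  where open ℝ-Reasoning

combination-- : ∀ {k} (c : Fin k → ℝ) g h →
  combination c (λ i → g i ℤ.- h i) +ℝ combination c h ≈ combination c g
combination-- c g h = begin
  combination c (λ i → g i ℤ.- h i) +ℝ combination c h
    ≈⟨ ℝ-sum.∑-distrib-+ (λ i → c i *ℝ ℤ→ℝ (g i ℤ.- h i)) (λ i → c i *ℝ ℤ→ℝ (h i)) ⟨
  sum (λ i → c i *ℝ ℤ→ℝ (g i ℤ.- h i) +ℝ c i *ℝ ℤ→ℝ (h i))
    ≈⟨ ℝ-sum.sum-cong-≋ (λ i → term (c i) (g i) (h i)) ⟩
  combination c g ∎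
  where
  open ℝ-Reasoning
  term : ∀ x a b → x *ℝ ℤ→ℝ (a ℤ.- b) +ℝ x *ℝ ℤ→ℝ b ≈ x *ℝ ℤ→ℝ a
  term x a b = begin
    x *ℝ ℤ→ℝ (a ℤ.- b) +ℝ x *ℝ ℤ→ℝ b            ≈⟨ ℝ-ring.distribˡ x (ℤ→ℝ (a ℤ.- b)) (ℤ→ℝ b) ⟨
    x *ℝ (ℤ→ℝ (a ℤ.- b) +ℝ ℤ→ℝ b)
      ≈⟨ ℝ-ring.*-congˡ {x} (ℝ-ring.+-congʳ (ℤ→ℝ-homo-- a b)) ⟩
    x *ℝ (ℤ→ℝ a +ℝ -ℝ ℤ→ℝ b +ℝ ℤ→ℝ b)
      ≈⟨ ℝ-ring.*-congˡ {x} (ℝ-props.//-rightDividesˡ (ℤ→ℝ b) (ℤ→ℝ a)) ⟩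
    x *ℝ ℤ→ℝ a                                  ∎

annihilator-subtractive : ∀ {k} (c : Fin k → ℝ) → Subtractive (λ g → combination c g ≈ 0ℝ)
annihilator-subtractive c = record
  { respects = λ eq h → ℝ-ring.trans
      (≈-reflexive (ℝ-sum.sum-cong-≗ λ i → cong (λ w → c i *ℝ ℤ→ℝ w) (sym (eq i)))) h
  ; subtract = λ {g} {h} gz hz → begin
      combination c (λ i → g i ℤ.- h i)                          ≈⟨ ℝ-ring.+-identityʳ _ ⟨
      combination c (λ i → g i ℤ.- h i) +ℝ 0ℝ
        ≈⟨ ℝ-ring.+-congˡ {combination c (λ i → g i ℤ.- h i)} hz ⟨
      combination c (λ i → g i ℤ.- h i) +ℝ combination c h       ≈⟨ combination-- c g h ⟩
      combination c g                                            ≈⟨ gz ⟩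
      0ℝ                                                         ∎ }
  where open ℝ-Reasoning

-- Independence of rows is read off from the columns: it suffices that integer
-- combinations of columns produce a nonzero multiple of every unit vector.
independent : ∀ {I J : Set} {k} (F : I → J → Sign) (rows : Fin k → I) →
  (∀ N → Subtractive N → (∀ v → N (λ i → signToℤ (F (rows i) v))) →
    ∀ i → ∃[ z ] z ≢ 0ℤ × N (δ i z)) →
  LinearlyIndependent (λ i v → signToℝ (F (rows i) v))
independent F rows span c h i =
  let column : ∀ v → combination c (λ i → signToℤ (F (rows i) v)) ≈ 0ℝ
      column v = ℝ-ring.trans (ℝ-sum.sum-cong-≋ λ i′ →
        ℝ-ring.*-congˡ {c i′} (ℤ→ℝ-signToℤ (F (rows i′) v))) (h v)
      (z , z≢0 , e) =
        span (λ g → combination c g ≈ 0ℝ) (annihilator-subtractive c) column i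
  in *-ℤ→ℝ-cancel (c i) z z≢0 (ℝ-ring.trans (ℝ-ring.sym (combination-δ c i z)) e)

-- The block construction

-- The `j`-th forward difference at a point. The recursion replaces `p` by its first difference,
-- which is what `tensor` does in each coordinate.
diff : ℕ → (ℕ → ℤ) → ℕ → ℤ
diff zero    p = p
diff (suc j) p = diff j λ i → p (suc i) ℤ.- p i

-- The multiple by `z` of the unit vector at `ws`, written as a product over the coordinates so that
-- `tensor` can peel off one at a time.
δᵛ : ∀ {q j} → Vec (Fin q) j → ℤ → Vec (Fin q) j → ℤ
δᵛ []       z us = z
δᵛ (w ∷ ws) z us = δ w (δᵛ ws z (tail us)) (head us)

-- The row entry u and the column entry v of a block are one-hot vectors with ones at
-- suc u and v, so the column entry zero never hits.
hit miss : ∀ {q} → Fin q → Fin (suc q) → ℕ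
hit u zero    = 0
hit u (suc v) = if does (v ≟ᶠ u) then 1 else 0
miss u zero    = 1
miss u (suc v) = if does (v ≟ᶠ u) then 0 else 1

hits misses : ∀ {q j} → Vec (Fin q) j → Vec (Fin (suc q)) j → ℕ
hits []       []       = 0
hits (u ∷ us) (v ∷ vs) = hit u v + hits us vs
misses []       []       = 0
misses (u ∷ us) (v ∷ vs) = miss u v + misses us vs

hits+misses : ∀ {q j} (us : Vec (Fin q) j) vs → hits us vs + misses us vs ≡ j
hits+misses [] [] = refl
hits+misses (u ∷ us) (zero ∷ vs) = trans (+-suc (hits us vs) _) (cong suc (hits+misses us vs))
hits+misses (u ∷ us) (suc v ∷ vs) with v ≟ᶠ u
... | yes _ = cong suc (hits+misses us vs)
... | no _ = trans (+-suc (hits us vs) _) (cong suc (hits+misses us vs))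

δ-- : ∀ {k} (i : Fin k) a b i′ → δ i a i′ ℤ.- δ i b i′ ≡ δ i (a ℤ.- b) i′
δ-- i a b i′ with i ≟ᶠ i′
... | yes _ = refl
... | no _ = refl

-- In each coordinate, subtracting the column entry zero from the column entry
-- suc w singles out the row entry w and takes one difference of p.
tensor : ∀ {q} j (p : ℕ → ℤ) (N : (Vec (Fin q) j → ℤ) → Set) → Subtractive N →
  (∀ vs → N (λ us → p (hits us vs))) → ∀ ws → N (δᵛ ws (diff j p 0))
tensor zero p N S cols [] = Subtractive.respects S (λ { [] → refl }) (cols [])
tensor {q} (suc j) p N S cols (w ∷ ws) = tensor j (λ i → p (suc i) ℤ.- p i) N′ S′ cols′ ws
  where
  open Subtractive S
  -- `N′ g` says that `N` holds of the vector that is `g` on the rows with head `w` and zero on all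
  -- others.
  N′ : (Vec (Fin q) j → ℤ) → Set
  N′ g = N λ us → δ w (g (tail us)) (head us)
  S′ : Subtractive N′
  S′ = record
    { respects = λ eq → respects λ us → cong (λ z → δ w z (head us)) (eq (tail us))
    ; subtract = λ {g} {h} a b →
        respects (λ us → δ-- w (g (tail us)) (h (tail us)) (head us)) (subtract a b) }
  step : ∀ u m → p (hit u (suc w) + m) ℤ.- p m ≡ δ w (p (suc m) ℤ.- p m) u
  step u m with w ≟ᶠ u
  ... | yes _ = refl
  ... | no _ = ℤₚ.+-inverseʳ (p m)
  cols′ : ∀ vs → N′ λ us → p (suc (hits us vs)) ℤ.- p (hits us vs)
  cols′ vs = respects (λ { (u ∷ us) → step u (hits us vs) }) 
    (subtract (cols (suc w ∷ vs)) (cols (zero ∷ vs)))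

label : ∀ {q} j → Fin (q ^ j) → Vec (Fin q) j
label zero    _ = []
label {q} (suc j) i = let (u , i′) = remQuot {q} (q ^ j) i in u ∷ label j i′

label-injective : ∀ {q} j {i i′ : Fin (q ^ j)} → label j i ≡ label j i′ → i ≡ i′
label-injective zero {zero} {zero} _ = refl
label-injective {q} (suc j) {i} {i′} e = begin
  i                                      ≡⟨ combine-remQuot {q} (q ^ j) i ⟨
  uncurry combine (remQuot {q} (q ^ j) i)
    ≡⟨ cong₂ combine (cong head e) (label-injective j (cong tail e)) ⟩
  uncurry combine (remQuot {q} (q ^ j) i′) ≡⟨ combine-remQuot {q} (q ^ j) i′ ⟩
  i′                                     ∎
  where open ≡-Reasoning

δᵛ-diag : ∀ {q j} (ws : Vec (Fin q) j) z → δᵛ ws z ws ≡ z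
δᵛ-diag []       z = refl
δᵛ-diag (w ∷ ws) z = trans (δ-diag w _) (δᵛ-diag ws z)

δᵛ-off : ∀ {q j} (ws us : Vec (Fin q) j) z → ws ≢ us → δᵛ ws z us ≡ 0ℤ
δᵛ-off []       []       z ne = contradiction refl ne
δᵛ-off (w ∷ ws) (u ∷ us) z ne with w ≟ᶠ u
... | yes refl = δᵛ-off ws us z (ne ∘ cong (w ∷_))
... | no _     = refl

δᵛ-label : ∀ {q} j z (i i′ : Fin (q ^ j)) → δᵛ (label j i) z (label j i′) ≡ δ i z i′
δᵛ-label j z i i′ with i ≟ᶠ i′
... | yes refl = δᵛ-diag (label j i) z
... | no ne    = δᵛ-off _ _ z (ne ∘ label-injective j)

-- Profiles of one-hot blocks

onehot : ∀ {n} → Fin n → Vec Bool n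
onehot zero    = true ∷ replicate _ false
onehot (suc i) = false ∷ onehot i

zeros-profile : ∀ n → Profile (replicate n false) (replicate n false) 0 0 0 n
zeros-profile zero    = []
zeros-profile (suc n) = 00∷ (zeros-profile n)

zeros-onehot-profile : ∀ {n} (v : Fin (suc n)) → Profile (replicate (suc n) false) (onehot v) 0 0 1 n
zeros-onehot-profile {n}     zero    = 01∷ (zeros-profile n)
zeros-onehot-profile {suc n} (suc v) = 00∷ (zeros-onehot-profile v)

onehot-profile-≡ : ∀ {n} (u : Fin (suc n)) → Profile (onehot u) (onehot u) 1 0 0 n
onehot-profile-≡ {n}     zero    = 11∷ (zeros-profile n)
onehot-profile-≡ {suc n} (suc u) = 00∷ (onehot-profile-≡ u)

onehot-profile-≢ : ∀ {n} (u v : Fin (2 + n)) → u ≢ v → Profile (onehot u) (onehot v) 0 1 1 n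
onehot-profile-≢ zero    zero    ne = contradiction refl ne
onehot-profile-≢ zero    (suc v) ne = 10∷ (zeros-onehot-profile v)
onehot-profile-≢ (suc u) zero    ne = 01∷ (profile-swap (zeros-onehot-profile u))
onehot-profile-≢ {suc n} (suc u) (suc v) ne = 00∷ (onehot-profile-≢ u v (ne ∘ cong suc))
onehot-profile-≢ {zero}  (suc zero) (suc zero) ne = contradiction refl ne

-- Both vectors have weight one, so a miss produces one pair 10 and one pair 01, and the same count
-- serves for both.
block-profile : ∀ {q} (u : Fin (suc q)) (v : Fin (2 + q)) →
  ∃[ d ] Profile (onehot (suc u)) (onehot v) (hit u v) (miss u v) (miss u v) d
block-profile u zero = _ , onehot-profile-≢ (suc u) zero λ ()
block-profile u (suc v) with v ≟ᶠ u
... | yes refl = _ , onehot-profile-≡ (suc u)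
... | no ne    = _ , onehot-profile-≢ (suc u) (suc v) (ne ∘ sym ∘ Fin-suc-injective)

profile-++ : ∀ {m n a b c d a′ b′ c′ d′} {x y : Vec Bool m} {x′ y′ : Vec Bool n} →
  Profile x y a b c d → Profile x′ y′ a′ b′ c′ d′ →
  Profile (x ++ x′) (y ++ y′) (a + a′) (b + b′) (c + c′) (d + d′)
profile-++ []      Q = Q
profile-++ (11∷ P) Q = 11∷ (profile-++ P Q)
profile-++ (10∷ P) Q = 10∷ (profile-++ P Q)
profile-++ (01∷ P) Q = 01∷ (profile-++ P Q)
profile-++ (00∷ P) Q = 00∷ (profile-++ P Q)

-- Recursive rather than `j * suc q + m`, so that the concatenation in `onehots` has this length by
-- definition.
padded : ℕ → ℕ → ℕ → ℕ
padded q zero    m = m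
padded q (suc j) m = suc q + padded q j m

padded≡ : ∀ q j m → padded q j m ≡ j * suc q + m
padded≡ q zero    m = refl
padded≡ q (suc j) m = trans (cong (suc q +_) (padded≡ q j m)) (sym (+-assoc (suc q) (j * suc q) m))

onehots : ∀ {q j m} → Vec (Fin (suc q)) j → Vec Bool m → Vec Bool (padded q j m)
onehots []       x = x
onehots (u ∷ us) x = onehot u ++ onehots us x

onehots-profile : ∀ {q j m a b c d} {x y : Vec Bool m} → Profile x y a b c d →
  (us : Vec (Fin (suc q)) j) (vs : Vec (Fin (2 + q)) j) →
  ∃[ d′ ] Profile (onehots (map suc us) x) (onehots vs y)
                  (hits us vs + a) (misses us vs + b) (misses us vs + c) d′
onehots-profile P [] [] = _ , P
onehots-profile {a = a} {b} {c} P (u ∷ us) (v ∷ vs)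
  rewrite +-assoc (hit u v) (hits us vs) a
        | +-assoc (miss u v) (misses us vs) b
        | +-assoc (miss u v) (misses us vs) c =
  _ , profile-++ (proj₂ (block-profile u v)) (proj₂ (onehots-profile P us vs))

RankBound : ∀ {n} → BoolFun₂ n → ℕ → Set
RankBound {n} f r = ∀ k (rows : Fin k → Vec Bool n) →
  LinearlyIndependent (λ i → inputMatrix f (rows i)) → k ≤ r

-- All rows used have weight j + a + b and all columns j + a + c, so the entries depend on the
-- number of hits alone. The counts `a`, `b`, `c`, `d` describe the padding outside the blocks.
rank-blocks : ∀ {n r} {f : BoolFun₂ n} → RankBound f r → ∀ q j a b c d →
  n ≡ j * (2 + q) + ((a + b) + (c + d)) → (p : ℕ → ℤ) →
  (∀ s t → s + t ≡ j → ∀ {x y d′} → Profile x y (s + a) (t + b) (t + c) d′ →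
    signToℤ (f x y) ≡ p s) →
  diff j p 0 ≢ 0ℤ → suc q ^ j ≤ r
rank-blocks {r = r} {f} bound q j a b c d n≡ p vals nz =
  go {f = f} (trans n≡ (sym (padded≡ (suc q) j _))) bound vals
  where
  m = (a + b) + (c + d)
  -- Generalizing `n` and `f` lets the equation for the length be matched with `refl`.
  go : ∀ {n} {f : BoolFun₂ n} → n ≡ padded (suc q) j m → RankBound f r →
    (∀ s t → s + t ≡ j → ∀ {x y d′} → Profile x y (s + a) (t + b) (t + c) d′ →
      signToℤ (f x y) ≡ p s) → suc q ^ j ≤ r
  go {f = f} refl bound vals = bound (suc q ^ j) rows (independent f rows span)
    where
    pad = canonical m a b c
    row : Vec (Fin (suc q)) j → Vec Bool (padded (suc q) j m)
    row us = onehots (map suc us) (proj₁ pad)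
    rows = row ∘ label j
    entry : ∀ us vs → signToℤ (f (row us) (onehots vs (proj₂ pad))) ≡ p (hits us vs)
    entry us vs = vals (hits us vs) (misses us vs) (hits+misses us vs)
      (proj₂ (onehots-profile (canonical-profile m refl) us vs))
    span : ∀ N → Subtractive N → (∀ y → N (λ i → signToℤ (f (rows i) y))) →
           ∀ i → ∃[ z ] z ≢ 0ℤ × N (δ i z)
    span N S cols i = diff j p 0 , nz , respects (δᵛ-label j (diff j p 0) i)
      (tensor j p N′ S′
        (λ vs → respects (λ i′ → entry (label j i′) vs) (cols (onehots vs (proj₂ pad))))
        (label j i))
      where
      open Subtractive S
      N′ : (Vec (Fin (suc q)) j → ℤ) → Set
      N′ g = N (g ∘ label j)
      S′ : Subtractive N′
      S′ = record { respects = λ e → respects (e ∘ label j) ; subtract = subtract }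

-- Finite differences

module ℤ+ = GroupProperties (AbelianGroup.group ℤₚ.+-0-abelianGroup)

diff-cong : ∀ j {p q : ℕ → ℤ} i → (∀ t → t ≤ j → p (t + i) ≡ q (t + i)) → diff j p i ≡ diff j q i
diff-cong zero    i h = h 0 z≤n
diff-cong (suc j) i h = diff-cong j i λ t t≤j →
  cong₂ ℤ._-_ (h (suc t) (s≤s t≤j)) (h t (m≤n⇒m≤1+n t≤j))

diff-shift : ∀ j (p : ℕ → ℤ) k i → diff j (λ t → p (t + k)) i ≡ diff j p (i + k)
diff-shift zero    p k i = refl
diff-shift (suc j) p k i = diff-shift j (λ t → p (suc t) ℤ.- p t) k i

diff-suc : ∀ j (p : ℕ → ℤ) i → diff (suc j) p i ≡ diff j p (suc i) ℤ.- diff j p i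
diff-suc zero    p i = refl
diff-suc (suc j) p i = diff-suc j (λ t → p (suc t) ℤ.- p t) i

diff-+ : ∀ j k (p : ℕ → ℤ) i → diff (j + k) p i ≡ diff k (diff j p) i
diff-+ zero    k p i = refl
diff-+ (suc j) k p i = diff-+ j k (λ t → p (suc t) ℤ.- p t) i

-- Modulo 2, Δ^(2^k) is the difference of step 2^k (freshman's dream).
diff-2^ : ∀ k p i → ∃[ z ] diff (2 ^ k) p i ≡ (p (2 ^ k + i) ℤ.- p i) ℤ.+ pos 2 ℤ.* z
diff-2^ zero    p i = 0ℤ , sym (ℤₚ.+-identityʳ _)
diff-2^ (suc k) p i =
  let j = 2 ^ k
      (u , eu) = diff-2^ k (diff j p) i
      (v , ev) = diff-2^ k p (j + i)
      (w , ew) = diff-2^ k p i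
  -- Applying the step `j` twice leaves (a - b) - (b - c) = (a - c) - 2 (b - c), whence the last
  -- summand of the witness.
  in u ℤ.+ v ℤ.- w ℤ.- (p (j + i) ℤ.- p i) , (begin
    diff (2 * j) p i           ≡⟨ cong (λ t → diff (j + t) p i) (+-identityʳ j) ⟩
    diff (j + j) p i           ≡⟨ diff-+ j j p i ⟩
    diff j (diff j p) i        ≡⟨ eu ⟩
    (diff j p (j + i) ℤ.- diff j p i) ℤ.+ pos 2 ℤ.* u
      ≡⟨ cong₂ (λ s t → (s ℤ.- t) ℤ.+ pos 2 ℤ.* u) ev ew ⟩
    ((p (j + (j + i)) ℤ.- p (j + i)) ℤ.+ pos 2 ℤ.* v ℤ.- ((p (j + i) ℤ.- p i) ℤ.+ pos 2 ℤ.* w)) ℤ.+ pos 2 ℤ.* u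
      ≡⟨ rearrange (p (j + (j + i))) (p (j + i)) (p i) u v w ⟩
    (p (j + (j + i)) ℤ.- p i) ℤ.+ pos 2 ℤ.* (u ℤ.+ v ℤ.- w ℤ.- (p (j + i) ℤ.- p i))
      ≡⟨ cong (λ t → (p t ℤ.- p i) ℤ.+ pos 2 ℤ.* (u ℤ.+ v ℤ.- w ℤ.- (p (j + i) ℤ.- p i)))
           (trans (sym (+-assoc j j i)) (cong (λ t → j + t + i) (sym (+-identityʳ j)))) ⟩
    (p (2 * j + i) ℤ.- p i) ℤ.+ pos 2 ℤ.* (u ℤ.+ v ℤ.- w ℤ.- (p (j + i) ℤ.- p i)) ∎)
  where
  open ≡-Reasoning
  rearrange : ∀ a b c u v w →
    ((a ℤ.- b) ℤ.+ pos 2 ℤ.* v ℤ.- ((b ℤ.- c) ℤ.+ pos 2 ℤ.* w)) ℤ.+ pos 2 ℤ.* u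
      ≡ (a ℤ.- c) ℤ.+ pos 2 ℤ.* (u ℤ.+ v ℤ.- w ℤ.- (b ℤ.- c))
  rearrange = ℤ-Solver.solve-∀

-- An arithmetic progression that is constant along a period is constant, so
-- periodicity lowers the order of a vanishing difference down to one.
module _ (p : ℕ → ℤ) (j m : ℕ) (2j≤ : suc j + j ≤ m)
         (periodic : ∀ i → suc j + i ≤ m → p (suc j + i) ≡ p i) where

  private
    x≡y+[x-y] : ∀ x y → x ≡ y ℤ.+ (x ℤ.- y)
    x≡y+[x-y] = ℤ-Solver.solve-∀

    linear : ∀ e i c → (∀ t → t ≤ i → diff (suc e) p t ≡ c) →
      diff e p (suc i) ≡ diff e p 0 ℤ.+ pos (suc i) ℤ.* c
    linear e zero c h = begin
      diff e p 1
        ≡⟨ x≡y+[x-y] (diff e p 1) (diff e p 0) ⟩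
      diff e p 0 ℤ.+ (diff e p 1 ℤ.- diff e p 0)
        ≡⟨ cong (ℤ._+_ (diff e p 0))
             (trans (sym (diff-suc e p 0)) (trans (h 0 z≤n) (sym (ℤₚ.*-identityˡ c)))) ⟩
      diff e p 0 ℤ.+ pos 1 ℤ.* c
        ∎
      where
      open ≡-Reasoning
    linear e (suc i) c h = begin
      diff e p (2 + i)
        ≡⟨ x≡y+[x-y] (diff e p (2 + i)) (diff e p (suc i)) ⟩
      diff e p (suc i) ℤ.+ (diff e p (2 + i) ℤ.- diff e p (suc i))
        ≡⟨ cong₂ ℤ._+_ (linear e i c (λ t t≤i → h t (m≤n⇒m≤1+n t≤i)))
                        (trans (sym (diff-suc e p (suc i))) (h (suc i) ≤-refl)) ⟩
      diff e p 0 ℤ.+ pos (suc i) ℤ.* c ℤ.+ c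
        ≡⟨ collect (diff e p 0) (pos (suc i)) c ⟩
      diff e p 0 ℤ.+ pos (2 + i) ℤ.* c
        ∎
      where
      open ≡-Reasoning
      collect : ∀ a b c → a ℤ.+ b ℤ.* c ℤ.+ c ≡ a ℤ.+ (pos 1 ℤ.+ b) ℤ.* c
      collect = ℤ-Solver.solve-∀

    constant : ∀ e i → (∀ t → t < i → diff (suc e) p t ≡ 0ℤ) → diff e p i ≡ diff e p 0
    constant e zero    h = refl
    constant e (suc i) h = trans (linear e i 0ℤ (λ t t≤i → h t (s≤s t≤i)))
      (trans (cong (ℤ._+_ (diff e p 0)) (ℤₚ.*-zeroʳ (pos (suc i)))) (ℤₚ.+-identityʳ _))

    descend : ∀ e → e ≤ j → (∀ t → suc e + t ≤ m → diff (suc e) p t ≡ 0ℤ) →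
              ∀ t → suc t ≤ m → p (suc t) ≡ p t
    descend zero e≤j h t t<m = ℤₚ.i-j≡0⇒i≡j _ _ (h t t<m)
    descend (suc e) e<j h = descend e (<⇒≤ e<j) λ t le → trans (const t le) slope≡0
      where
      slope = diff (suc e) p 0
      const : ∀ t → suc e + t ≤ m → diff (suc e) p t ≡ slope
      const t le = constant (suc e) t λ t′ t′<t → h t′
        (≤-trans (≤-reflexive (sym (+-suc (suc e) t′))) (≤-trans (+-monoʳ-≤ (suc e) t′<t) le))
      -- The difference at 0 reads `p` only at indices up to `e`, which is at most `j`; `2j≤` keeps
      -- their translates by `suc j` inside the window.
      wrap : diff e p (suc j) ≡ diff e p 0
      wrap = trans (sym (diff-shift e p (suc j) 0)) (diff-cong e 0 λ t t≤e →
        trans (cong p (+-comm (t + 0) (suc j)))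
              (periodic (t + 0) (≤-trans (+-monoʳ-≤ (suc j)
                (≤-trans (≤-reflexive (+-identityʳ t)) (≤-trans t≤e (<⇒≤ e<j)))) 2j≤)))
      jslope : pos (suc j) ℤ.* slope ≡ 0ℤ
      jslope = ℤ+.identityʳ-unique (diff e p 0) _ (trans (sym (linear e j slope λ t t≤j →
          const t (≤-trans (+-mono-≤ (m≤n⇒m≤1+n e<j) t≤j) 2j≤))) wrap)
      slope≡0 : slope ≡ 0ℤ
      slope≡0 with ℤₚ.i*j≡0⇒i≡0∨j≡0 (pos (suc j)) jslope
      ... | inj₂ e = e

  periodic-constant : (∀ t → suc j + t ≤ m → diff (suc j) p t ≡ 0ℤ) →
                      ∀ t → suc t ≤ m → p (suc t) ≡ p t
  periodic-constant = descend j ≤-refl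

-- Lower bounds on the rank

-- The two pairs have equal weights, 1 + a + b and 1 + a + c, and consecutive intersection sizes.
-- The indices are the smaller of the two counts of each kind, so that negating an argument only
-- permutes them.
record Jump {n} (f : BoolFun₂ n) (a b c d : ℕ) : Set where
  constructor jump
  field
    {x y x′ y′} : Vec Bool n
    below  : Profile x y a (suc b) (suc c) d
    above  : Profile x′ y′ (suc a) b c (suc d)
    differ : f x y ≢ f x′ y′

map-not-involutive : ∀ {n} (x : Vec Bool n) → map not (map not x) ≡ x
map-not-involutive x = trans (sym (map-∘ not not x)) (trans (map-cong not-involutive x) (map-id x))

infix 8 _∘notˡ _∘notʳ
_∘notˡ _∘notʳ : ∀ {n} → BoolFun₂ n → BoolFun₂ n
(f ∘notˡ) x y = f (map not x) y
(f ∘notʳ) x y = f x (map not y)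

module _ {n} {f : BoolFun₂ n} where

  jump-notˡ : ∀ {a b c d} → Jump f a b c d → Jump (f ∘notˡ) c d a b
  jump-notˡ (jump P Q ne) = jump (profile-notˡ Q) (profile-notˡ P) λ e →
    ne (sym (trans (cong (λ x → f x _) (sym (map-not-involutive _)))
                   (trans e (cong (λ x → f x _) (map-not-involutive _)))))

  jump-notʳ : ∀ {a b c d} → Jump f a b c d → Jump (f ∘notʳ) b a d c
  jump-notʳ (jump P Q ne) = jump (profile-notʳ Q) (profile-notʳ P) λ e →
    ne (sym (trans (cong (f _) (sym (map-not-involutive _)))
                   (trans e (cong (f _) (map-not-involutive _)))))

  invariant-notˡ : ProfileInvariant f → ProfileInvariant (f ∘notˡ)
  invariant-notˡ inv P Q with profile-d-unique P Q
  ... | refl = inv (profile-notˡ P) (profile-notˡ Q)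

  invariant-notʳ : ProfileInvariant f → ProfileInvariant (f ∘notʳ)
  invariant-notʳ inv P Q with profile-d-unique P Q
  ... | refl = inv (profile-notʳ P) (profile-notʳ Q)

  rankBound-notˡ : ∀ {r} → RankBound f r → RankBound (f ∘notˡ) r
  rankBound-notˡ bound k rows indep = bound k (map not ∘ rows) indep

  rankBound-notʳ : ∀ {r} → RankBound f r → RankBound (f ∘notʳ) r
  rankBound-notʳ bound k rows indep = bound k rows λ c h → indep c λ y → h (map not y)

profile-cong : ∀ {n a b c d a′ b′ c′} {x y : Vec Bool n} → a ≡ a′ → b ≡ b′ → c ≡ c′ →
  Profile x y a b c d → Profile x y a′ b′ c′ d
profile-cong refl refl refl P = P

signToℤ-injective : ∀ {s t} → signToℤ s ≡ signToℤ t → s ≡ t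
signToℤ-injective {Sign.+} {Sign.+} _ = refl
signToℤ-injective {Sign.-} {Sign.-} _ = refl

module _ {n r} {f : BoolFun₂ n} (inv : ProfileInvariant f) (bound : RankBound f r) where

  -- A single block that absorbs all `d` common pairs 00 has d + 2 coordinates and thus d + 1 rows;
  -- the jump is a nonzero first difference.
  d<rank : ∀ {a b c d} → Jump f a b c d → d < r
  d<rank {a} {b} {c} {d} (jump {x} {y} {x′} {y′} P Q ne) =
    subst (_≤ r) (*-identityʳ (suc d))
      (rank-blocks {f = f} bound d 1 a b c 0 (trans (profile-length P) (length≡ a b c d)) p vals nz)
    where
    length≡ : ∀ a b c d → (a + suc b) + (suc c + d) ≡ 1 * (2 + d) + ((a + b) + (c + 0))
    length≡ = ℕ-Solver.solve-∀
    p : ℕ → ℤ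
    p zero    = signToℤ (f x y)
    p (suc _) = signToℤ (f x′ y′)
    vals : ∀ s t → s + t ≡ 1 → ∀ {x y d′} → Profile x y (s + a) (t + b) (t + c) d′ →
      signToℤ (f x y) ≡ p s
    vals zero       (suc zero) _ R = cong signToℤ (inv R P)
    vals (suc zero) zero       _ R = cong signToℤ (inv R Q)
    nz : diff 1 p 0 ≢ 0ℤ
    nz e = ne (sym (signToℤ-injective (ℤₚ.i-j≡0⇒i≡j (p 1) (p 0) e)))

-- n + 2 is the sum of the four counts, each increased by one. Negating x, y or both moves each
-- count into the role of `d` in `d<rank`.
n+2≤4rank : ∀ {n r} {f : BoolFun₂ n} → ProfileInvariant f → RankBound f r →
  ∀ {a b c d} → Jump f a b c d → n + 2 ≤ 4 * r
n+2≤4rank {n} {r} {f} inv bound {a} {b} {c} {d} J@(jump P _ _) = begin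
  n + 2                                           ≡⟨ cong (_+ 2) (profile-length P) ⟩
  (a + suc b) + (suc c + d) + 2                   ≡⟨ arrange a b c d ⟩
  suc a + (suc b + (suc c + (suc d + 0)))
    ≤⟨ +-mono-≤ a<r (+-mono-≤ b<r (+-mono-≤ c<r (+-mono-≤ d<r z≤n))) ⟩
  4 * r                                           ∎
  where
  open ≤-Reasoning
  arrange : ∀ a b c d → (a + suc b) + (suc c + d) + 2 ≡ suc a + (suc b + (suc c + (suc d + 0)))
  arrange = ℕ-Solver.solve-∀
  invˡ = invariant-notˡ {f = f} inv
  invʳ = invariant-notʳ {f = f} inv
  boundˡ = rankBound-notˡ {f = f} bound
  boundʳ = rankBound-notʳ {f = f} bound
  d<r : d < r
  d<r = d<rank {f = f} inv bound J
  c<r : c < r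
  c<r = d<rank {f = f ∘notʳ} invʳ boundʳ (jump-notʳ J)
  b<r : b < r
  b<r = d<rank {f = f ∘notˡ} invˡ boundˡ (jump-notˡ J)
  a<r : a < r
  a<r = d<rank {f = f ∘notˡ ∘notʳ}
    (invariant-notʳ {f = f ∘notˡ} invˡ) (rankBound-notʳ {f = f ∘notˡ} boundˡ)
    (jump-notʳ {f = f ∘notˡ} (jump-notˡ J))

zeros-weight-profile : ∀ {n} (y : Vec Bool n) → ∃[ d ] Profile (replicate n false) y 0 0 (weight y) d
zeros-weight-profile [] = _ , []
zeros-weight-profile (true  ∷ y) = _ , 01∷ (proj₂ (zeros-weight-profile y))
zeros-weight-profile (false ∷ y) = _ , 00∷ (proj₂ (zeros-weight-profile y))

-- The zero row is constant on each weight, unlike the row of a jump.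
2≤rank : ∀ {n r} {f : BoolFun₂ n} → ProfileInvariant f → RankBound f r →
  ∀ {a b c d} → Jump f a b c d → 2 ≤ r
2≤rank {n} {r} {f} inv bound {a} {b} {c} {d} (jump P Q ne) =
  go (trans (profile-length P) (length≡ a b c d)) inv bound P Q ne
  where
  m = (a + b) + (c + d)
  length≡ : ∀ a b c d → (a + suc b) + (suc c + d) ≡ 2 + ((a + b) + (c + d))
  length≡ = ℕ-Solver.solve-∀
  go : ∀ {n} {f : BoolFun₂ n} → n ≡ 2 + m → ProfileInvariant f → RankBound f r →
    ∀ {x y x′ y′} → Profile x y a (suc b) (suc c) d → Profile x′ y′ (suc a) b c (suc d) →
    f x y ≢ f x′ y′ → 2 ≤ r
  go {f = f} refl inv bound P Q ne = bound 2 rows (independent f rows span)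
    where
    pad = canonical m a b c
    pad-profile : Profile (proj₁ pad) (proj₂ pad) a b c d
    pad-profile = canonical-profile m refl
    u y y′ : Vec Bool (2 + m)
    u  = true ∷ false ∷ proj₁ pad
    y  = false ∷ true ∷ proj₂ pad
    y′ = true ∷ false ∷ proj₂ pad
    rows : Fin 2 → Vec Bool (2 + m)
    rows zero    = replicate _ false
    rows (suc _) = u
    differ : f u y ≢ f u y′
    differ e = ne (trans (inv P (10∷ (01∷ pad-profile))) (trans e (inv (11∷ (00∷ pad-profile)) Q)))
    same : f (rows zero) y ≡ f (rows zero) y′
    same = inv (proj₂ (zeros-weight-profile y)) (proj₂ (zeros-weight-profile y′))
    opposite : ∀ s t → s ≢ t → signToℤ s ℤ.- (0ℤ ℤ.- signToℤ t) ≡ 0ℤ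
    opposite Sign.+ Sign.+ ne = contradiction refl ne
    opposite Sign.+ Sign.- ne = refl
    opposite Sign.- Sign.+ ne = refl
    opposite Sign.- Sign.- ne = contradiction refl ne
    double≢0 : ∀ s → signToℤ s ℤ.- (0ℤ ℤ.- signToℤ s) ≢ 0ℤ
    double≢0 Sign.+ ()
    double≢0 Sign.- ()
    span : ∀ N → Subtractive N → (∀ y → N (λ i → signToℤ (f (rows i) y))) →
           ∀ i → ∃[ z ] z ≢ 0ℤ × N (δ i z)
    span N S cols (suc zero) = _ , (λ e → differ (signToℤ-injective (ℤₚ.i-j≡0⇒i≡j _ _ e))) ,
      respects (λ { zero       → trans (cong (λ s → s₀ ℤ.- signToℤ s) (sym same)) (ℤₚ.+-inverseʳ s₀)
                  ; (suc zero) → refl })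
        (subtract (cols y) (cols y′))
      where
      open Subtractive S
      s₀ = signToℤ (f (rows zero) y)
    -- Subtracting the negative of column `y′` adds the two columns: the opposite signs in row `u`
    -- cancel and the equal signs in the zero row double.
    span N S cols zero = _ , double≢0 (f (rows zero) y) ,
      respects (λ { zero       → cong₂ (λ s t → s₀ ℤ.- (s ℤ.- signToℤ t)) (ℤₚ.+-inverseʳ s₀) (sym same)
                  ; (suc zero) → trans (cong (λ z → s₁ ℤ.- (z ℤ.- signToℤ (f u y′))) (ℤₚ.+-inverseʳ s₁))
                                       (opposite (f u y) (f u y′) differ) })
        (subtract (cols y) (subtract (subtract (cols y) (cols y)) (cols y′)))
      where
      open Subtractive S
      s₀ = signToℤ (f (rows zero) y)
      s₁ = signToℤ (f u y)

-- Exponential rank from nonvanishing differences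

bit : Sign → ℤ
bit Sign.+ = 1ℤ
bit Sign.- = 0ℤ

diff-scale : ∀ j {p b : ℕ → ℤ} → (∀ i → p i ≡ pos 2 ℤ.* b i) → ∀ i → diff j p i ≡ pos 2 ℤ.* diff j b i
diff-scale zero    h i = h i
diff-scale (suc j) {p} {b} h = diff-scale j λ i → trans (cong₂ ℤ._-_ (h (suc i)) (h i))
  (distrib (b (suc i)) (b i))
  where
  distrib : ∀ x y → pos 2 ℤ.* x ℤ.- pos 2 ℤ.* y ≡ pos 2 ℤ.* (x ℤ.- y)
  distrib = ℤ-Solver.solve-∀

-- A sign is twice its bit minus one, and a single difference removes the constant. Bits are wanted
-- because 1 and -1 agree modulo 2, whereas 0 and 1 do not.
diff-sign : ∀ j (σ : ℕ → Sign) i → diff (suc j) (signToℤ ∘ σ) i ≡ pos 2 ℤ.* diff (suc j) (bit ∘ σ) i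
diff-sign j σ = diff-scale j λ i → go (σ (suc i)) (σ i)
  where
  go : ∀ s t → signToℤ s ℤ.- signToℤ t ≡ pos 2 ℤ.* (bit s ℤ.- bit t)
  go Sign.+ Sign.+ = refl
  go Sign.+ Sign.- = refl
  go Sign.- Sign.+ = refl
  go Sign.- Sign.- = refl

2*z≢±1 : ∀ z → ℤ.∣ pos 2 ℤ.* z ∣ ≢ 1
2*z≢±1 z e = even≢odd ℤ.∣ z ∣ 0 (trans (sym (ℤₚ.abs-* (pos 2) z)) e)

bit-parity : ∀ s t z → (bit s ℤ.- bit t) ℤ.+ pos 2 ℤ.* z ≡ 0ℤ → s ≡ t
bit-parity Sign.+ Sign.+ z e = refl
bit-parity Sign.- Sign.- z e = refl
bit-parity Sign.+ Sign.- z e = contradiction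
  (cong ℤ.∣_∣ (ℤ+.inverseʳ-unique 1ℤ (pos 2 ℤ.* z) e)) (2*z≢±1 z)
bit-parity Sign.- Sign.+ z e = contradiction
  (cong ℤ.∣_∣ (ℤ+.inverseʳ-unique (ℤ.- 1ℤ) (pos 2 ℤ.* z) e)) (2*z≢±1 z)

-- By `diff-2^` the vanishing differences make the bits periodic modulo 2; parity determines a bit,
-- so they are periodic and `periodic-constant` applies.
signs-constant : ∀ k m (σ : ℕ → Sign) → 2 * 2 ^ k ≤ suc m →
  (∀ t → 2 ^ k + t ≤ m → diff (2 ^ k) (signToℤ ∘ σ) t ≡ 0ℤ) →
  ∀ t → t < m → σ (suc t) ≡ σ t
signs-constant k m σ 2j≤ vanish t t<m with 2 ^ k in eq | m^n>0 2 k
... | suc j | _ = signToℤ-injective (periodic-constant (signToℤ ∘ σ) j m window periodic vanish t t<m)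
  where
  window : suc j + j ≤ m
  window = ≤-pred (≤-trans (≤-reflexive (arrange j)) 2j≤)
    where
    arrange : ∀ j → suc (suc j + j) ≡ 2 * suc j
    arrange = ℕ-Solver.solve-∀
  periodic : ∀ i → suc j + i ≤ m → signToℤ (σ (suc j + i)) ≡ signToℤ (σ i)
  periodic i le with diff-2^ k (bit ∘ σ) i
  ... | z , e rewrite eq = cong signToℤ (bit-parity (σ (suc j + i)) (σ i) z (trans (sym e) bits))
    where
    bits : diff (suc j) (bit ∘ σ) i ≡ 0ℤ
    bits with ℤₚ.i*j≡0⇒i≡0∨j≡0 (pos 2) (trans (sym (diff-sign j σ i)) (vanish i le))
    ... | inj₂ e = e

-- `σ t` is the value at intersection size t + (j + a), and the jump lies between `σ α` and
-- `σ (suc α)`. If the bound failed, `rank-blocks` would make all `j`-th differences in the window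
-- vanish, and `signs-constant` would exclude the jump. Each block of three coordinates contains at
-- least one pair 00, which the surplus `j` in the last count supplies.
window-rank : ∀ {n r} {f : BoolFun₂ n} → ProfileInvariant f → RankBound f r →
  ∀ k α β {a b c d} → let j = 2 ^ k in 2 * j ≤ suc (suc (α + β)) →
  Jump f ((j + α) + a) (β + b) (β + c) ((j + α) + d) → 2 ^ j ≤ r
window-rank {n} {r} {f} inv bound k α β {a} {b} {c} {d} 2j≤ (jump {x} {y} {x′} {y′} P Q ne) =
  decidable-stable (2 ^ j ≤? r) λ small → ne (begin
    f x y
      ≡⟨ value α (cong suc (+-comm β α)) (profile-cong (swap₃ j α a) refl refl P) ⟩
    σ α
      ≡⟨ signs-constant k m σ 2j≤ (vanish small) α (s≤s (m≤m+n α β)) ⟨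
    σ (suc α)
      ≡⟨ value (suc α) (trans (+-suc β α) (cong suc (+-comm β α)))
           (profile-cong (cong suc (swap₃ j α a)) refl refl Q) ⟨
    f x′ y′
      ∎)
  where
  open ≡-Reasoning
  j = 2 ^ k
  m = suc (α + β)
  swap₃ : ∀ j α a → (j + α) + a ≡ α + (j + a)
  swap₃ = ℕ-Solver.solve-∀
  σ : ℕ → Sign
  σ t = uncurry f (canonical n (t + (j + a)) ((m ∸ t) + b) ((m ∸ t) + c))
  value : ∀ t {w x y d} → w + t ≡ m → Profile x y (t + (j + a)) (w + b) (w + c) d → f x y ≡ σ t
  value t {w} w+t≡m R rewrite sym w+t≡m | m+n∸n≡m w t = inv R (canonical-profile n (profile-length R))
  vanish : ¬ (2 ^ j ≤ r) → ∀ t → j + t ≤ m → diff j (signToℤ ∘ σ) t ≡ 0ℤ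
  vanish small t j+t≤m = decidable-stable (diff j (signToℤ ∘ σ) t ℤ.≟ 0ℤ) λ nz → small
    (rank-blocks {f = f} bound 1 j (t + (j + a)) (w + b) (w + c) (t + d)
      (trans (profile-length P) (trans (length≡ j α β a b c d)
        (trans (cong (λ m → m + m + (j + j) + (a + b + c + d)) (sym (m∸n+n≡m j+t≤m)))
               (split j t w a b c d))))
      (λ s → signToℤ (σ (s + t)))
      (λ s s′ e R → cong signToℤ (value (s + t) (sum≡m s s′ e)
        (profile-cong (sym (+-assoc s t _)) (sym (+-assoc s′ w b)) (sym (+-assoc s′ w c)) R)))
      (λ e → nz (trans (sym (diff-shift j (signToℤ ∘ σ) t 0)) e)))
    where
    w = m ∸ (j + t)
    length≡ : ∀ j α β a b c d → ((j + α) + a + suc (β + b)) + (suc (β + c) + ((j + α) + d))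
      ≡ suc (α + β) + suc (α + β) + (j + j) + (a + b + c + d)
    length≡ = ℕ-Solver.solve-∀
    split : ∀ j t w a b c d → (w + (j + t)) + (w + (j + t)) + (j + j) + (a + b + c + d)
      ≡ j * 3 + ((t + (j + a) + (w + b)) + (w + c + (t + d)))
    split = ℕ-Solver.solve-∀
    sum≡m : ∀ s s′ → s + s′ ≡ j → (s′ + w) + (s + t) ≡ m
    sum≡m s s′ e = trans (regroup s s′ t w) (trans (cong (λ j → w + (j + t)) e) (m∸n+n≡m j+t≤m))
      where
      regroup : ∀ s s′ t w → (s′ + w) + (s + t) ≡ w + ((s + s′) + t)
      regroup = ℕ-Solver.solve-∀

-- Of the room 3 j, one `j` is split off from `α` as the surplus for the blocks, and 2 j remain for
-- the window.
centred-rank : ∀ {n r} {f : BoolFun₂ n} → ProfileInvariant f → RankBound f r →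
  ∀ k {α β a b c d} → let j = 2 ^ k in j ≤ α → α ≤ a → α ≤ d → β ≤ b → β ≤ c →
  3 * j ≤ suc (α + β) → Jump f a b c d → 2 ^ j ≤ r
centred-rank {f = f} inv bound k {β = β} j≤α α≤a α≤d β≤b β≤c 3j≤ J
  with α′ , refl ← m≤n⇒∃[o]m+o≡n j≤α
  with _ , refl ← m≤n⇒∃[o]m+o≡n α≤a
  with _ , refl ← m≤n⇒∃[o]m+o≡n α≤d
  with _ , refl ← m≤n⇒∃[o]m+o≡n β≤b
  with _ , refl ← m≤n⇒∃[o]m+o≡n β≤c
  = window-rank {f = f} inv bound k α′ β
      (m≤n⇒m≤1+n (+-cancelˡ-≤ (2 ^ k) _ _ (≤-trans 3j≤ (≤-reflexive (arrange (2 ^ k) α′ β))))) J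
  where
  arrange : ∀ j α β → suc (j + α + β) ≡ j + suc (α + β)
  arrange = ℕ-Solver.solve-∀

-- The block construction needs room for 2^k steps before the jump.  If there is none,
-- there is room after it, and negating y reverses the order of the intersection sizes.
rank-exponential : ∀ {n r} {f : BoolFun₂ n} → ProfileInvariant f → RankBound f r →
  ∀ k {a b c d} → let j = 2 ^ k in
  3 * j ≤ suc (a + b) → 3 * j ≤ suc (a + c) → 3 * j ≤ suc (d + b) → 3 * j ≤ suc (d + c) →
  Jump f a b c d → 2 ^ j ≤ r
rank-exponential {f = f} inv bound k {a} {b} {c} {d} ab ac db dc J = cases (j ≤? α)
  where
  j = 2 ^ k
  α = a ⊓ d
  β = b ⊓ c
  3j≤ : 3 * j ≤ suc (α + β)
  3j≤ with ⊓-sel a d | ⊓-sel b c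
  ... | inj₁ e | inj₁ e′ rewrite e | e′ = ab
  ... | inj₁ e | inj₂ e′ rewrite e | e′ = ac
  ... | inj₂ e | inj₁ e′ rewrite e | e′ = db
  ... | inj₂ e | inj₂ e′ rewrite e | e′ = dc
  -- With α < j, the bound `3j≤` leaves even 2 j ≤ β.
  j≤β : ¬ (j ≤ α) → j ≤ β
  j≤β j≰α = ≤-trans (m≤m+n j (j + 0)) (+-cancelˡ-≤ j _ _ (≤-trans 3j≤ (+-monoˡ-≤ β (≰⇒> j≰α))))
  cases : Dec (j ≤ α) → 2 ^ j ≤ _
  cases (yes j≤α) = centred-rank {f = f} inv bound k j≤α
    (m⊓n≤m a d) (m⊓n≤n a d) (m⊓n≤m b c) (m⊓n≤n b c) 3j≤ J
  cases (no j≰α) = centred-rank {f = f ∘notʳ}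
    (invariant-notʳ {f = f} inv) (rankBound-notʳ {f = f} bound) k (j≤β j≰α)
    (m⊓n≤m b c) (m⊓n≤n b c) (m⊓n≤m a d) (m⊓n≤n a d)
    (≤-trans 3j≤ (≤-reflexive (cong suc (+-comm α β)))) (jump-notʳ J)

-- The protocol

module _ {n} {f : BoolFun₂ n} (inv : ProfileInvariant f) (v w : ℕ)
         (noJump : ∀ {a b c d} → suc (a + b) ≡ v → suc (a + c) ≡ w → ¬ Jump f a b c d) where

  private
    -- Raises the intersection size by one at a time, through canonical pairs of the same weights; a
    -- change of value at any step would be a jump.
    climb : ∀ t {a b c d d′} {x y x′ y′ : Vec Bool n} → a + (t + b) ≡ v → a + (t + c) ≡ w →
      Profile x y a (t + b) (t + c) d → Profile x′ y′ (t + a) b c d′ → f x y ≡ f x′ y′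
    climb zero    _ _ P Q = inv P Q
    climb (suc t) {a} {b} {c} {d} ev ew P Q = trans
      (decidable-stable (f _ _ Signₚ.≟ f _ _)
        λ ne → noJump (trans (sym (+-suc a _)) ev) (trans (sym (+-suc a _)) ew) (jump P middle ne))
      (climb t (trans (sym (+-suc a _)) ev) (trans (sym (+-suc a _)) ew) middle
        (profile-cong (sym (+-suc t a)) refl refl Q))
      where
      length≡ : ∀ a b c d → (a + suc b) + (suc c + d) ≡ (suc a + b) + (c + suc d)
      length≡ = ℕ-Solver.solve-∀
      middle : Profile _ _ (suc a) (t + b) (t + c) (suc d)
      middle = canonical-profile n (trans (profile-length P) (length≡ a (t + b) (t + c) d))

    climb-≤ : ∀ {a b c d a′ b′ c′ d′} {x y x′ y′ : Vec Bool n} → a ≤ a′ →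
      a + b ≡ v → a + c ≡ w → a′ + b′ ≡ v → a′ + c′ ≡ w →
      Profile x y a b c d → Profile x′ y′ a′ b′ c′ d′ → f x y ≡ f x′ y′
    climb-≤ {a} {b} {c} {b′ = b′} {c′} a≤a′ ev ew ev′ ew′ P Q with t , refl ← m≤n⇒∃[o]m+o≡n a≤a′ =
      climb t (trans (cong (a +_) (sym b≡)) ev) (trans (cong (a +_) (sym c≡)) ew)
        (profile-cong refl b≡ c≡ P) (profile-cong (+-comm a t) refl refl Q)
      where
      b≡ : b ≡ t + b′
      b≡ = +-cancelˡ-≡ a _ _ (trans ev (trans (sym ev′) (+-assoc a t b′)))
      c≡ : c ≡ t + c′
      c≡ = +-cancelˡ-≡ a _ _ (trans ew (trans (sym ew′) (+-assoc a t c′)))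

  noJump⇒constant : ∀ x y x′ y′ → weight x ≡ v → weight y ≡ w → weight x′ ≡ v → weight y′ ≡ w →
    f x y ≡ f x′ y′
  noJump⇒constant x y x′ y′ xv yw x′v y′w with profile x y | profile x′ y′
  ... | a , _ , _ , _ , P | a′ , _ , _ , _ , Q
    with ev ← trans (sym (profile-weightˡ P)) xv | ew ← trans (sym (profile-weightʳ P)) yw
       | ev′ ← trans (sym (profile-weightˡ Q)) x′v | ew′ ← trans (sym (profile-weightʳ Q)) y′w
    with ≤-total a a′
  ... | inj₁ a≤a′ = climb-≤ a≤a′ ev ew ev′ ew′ P Q
  ... | inj₂ a′≤a = sym (climb-≤ a′≤a ev′ ew′ ev ew Q P)

-- Enumerating the vectors of small or large weight

module Position {A : Set} (_≟_ : DecidableEquality A) where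

  position : List A → A → ℕ
  position []       y = 0
  position (x ∷ xs) y = if does (x ≟ y) then 0 else suc (position xs y)

  nth : A → List A → ℕ → A
  nth z []       _       = z
  nth z (x ∷ xs) zero    = x
  nth z (x ∷ xs) (suc i) = nth z xs i

  position<length : ∀ {xs y} → y ∈ xs → position xs y < length xs
  position<length {x ∷ xs} {y} y∈ with x ≟ y
  ... | yes _ = s≤s z≤n
  position<length {x ∷ xs} (here y≡x) | no ne = contradiction (sym y≡x) ne
  position<length {x ∷ xs} (there y∈) | no _  = s≤s (position<length y∈)

  nth-position : ∀ {xs y} z → y ∈ xs → nth z xs (position xs y) ≡ y
  nth-position {x ∷ xs} {y} z y∈ with x ≟ y
  ... | yes x≡y = x≡y
  nth-position {x ∷ xs} z (here y≡x) | no ne = contradiction (sym y≡x) ne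
  nth-position {x ∷ xs} z (there y∈) | no _  = nth-position z y∈

light : ∀ n → ℕ → List (Vec Bool n)
light zero    m       = [] ∷ []
light (suc n) zero    = List.map (false ∷_) (light n 0)
light (suc n) (suc m) = List.map (false ∷_) (light n (suc m)) List.++ List.map (true ∷_) (light n m)

∈-light : ∀ {n} (x : Vec Bool n) m → weight x ≤ m → x ∈ light n m
∈-light []          m       _        = here refl
∈-light (false ∷ x) zero    le       = ∈-map⁺ _ (∈-light x 0 le)
∈-light (false ∷ x) (suc m) le       = ∈-++⁺ˡ (∈-map⁺ _ (∈-light x (suc m) le))
∈-light (true  ∷ x) (suc m) (s≤s le) = ∈-++⁺ʳ _ (∈-map⁺ _ (∈-light x m le))

length-light : ∀ n m → length (light n m) ≤ suc n ^ m
length-light zero    m    = ≤-reflexive (sym (^-zeroˡ m))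
length-light (suc n) zero = ≤-trans (≤-reflexive (length-map _ (light n 0))) (length-light n 0)
length-light (suc n) (suc m) = begin
  length (light (suc n) (suc m))
    ≡⟨ trans (length-++ (List.map _ (light n (suc m))))
         (cong₂ _+_ (length-map _ (light n (suc m))) (length-map _ (light n m))) ⟩
  length (light n (suc m)) + length (light n m)   ≤⟨ +-mono-≤ (length-light n (suc m)) (length-light n m) ⟩
  suc n ^ suc m + suc n ^ m                       ≡⟨ +-comm (suc n ^ suc m) (suc n ^ m) ⟩
  (2 + n) * suc n ^ m                             ≤⟨ *-monoʳ-≤ (2 + n) (^-monoˡ-≤ m (n≤1+n (suc n))) ⟩
  (2 + n) ^ suc m                                 ∎
  where open ≤-Reasoning

weight-not : ∀ {n} (x : Vec Bool n) → weight (map not x) + weight x ≡ n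
weight-not []          = refl
weight-not (true  ∷ x) = trans (+-suc (weight (map not x)) _) (cong suc (weight-not x))
weight-not (false ∷ x) = cong suc (weight-not x)

Extreme : ℕ → ℕ → ℕ → Set
Extreme n m w = w ≤ m ⊎ n ∸ w ≤ m

extreme? : ∀ n m w → Dec (Extreme n m w)
extreme? n m w = (w ≤? m) ⊎-dec (n ∸ w ≤? m)

extremes : ∀ n → ℕ → List (Vec Bool n)
extremes n m = light n m List.++ List.map (map not) (light n m)

∈-extremes : ∀ {n} (x : Vec Bool n) m → Extreme n m (weight x) → x ∈ extremes n m
∈-extremes x m (inj₁ le) = ∈-++⁺ˡ (∈-light x m le)
∈-extremes {n} x m (inj₂ le) = ∈-++⁺ʳ _
  (subst (_∈ List.map (map not) (light n m)) (map-not-involutive x)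
  (∈-map⁺ (map not) (∈-light (map not x) m (subst (_≤ m) n∸w≡ le))))
  where
  n∸w≡ : n ∸ weight x ≡ weight (map not x)
  n∸w≡ = trans (cong (_∸ weight x) (sym (weight-not x))) (m+n∸n≡m (weight (map not x)) (weight x))

length-extremes : ∀ n m {l} → n < 2 ^ l → length (extremes n m) ≤ 2 ^ suc (l * m)
length-extremes n m {l} n< = begin
  length (extremes n m)
    ≡⟨ trans (length-++ (light n m)) (cong (length (light n m) +_)
         (trans (length-map (map not) (light n m)) (sym (+-identityʳ _)))) ⟩
  2 * length (light n m)     ≤⟨ *-monoʳ-≤ 2 (length-light n m) ⟩
  2 * suc n ^ m              ≤⟨ *-monoʳ-≤ 2 (^-monoˡ-≤ m n<) ⟩
  2 * (2 ^ l) ^ m            ≡⟨ cong (2 *_) (^-*-assoc 2 l m) ⟩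
  2 ^ suc (l * m)            ∎
  where open ≤-Reasoning

-- node is alice or bob, and view selects the speaker's input.
module Speak {W X Y Z : Set}
  (node : (W → Bool) → Protocol X Y Z → Protocol X Y Z → Protocol X Y Z) (view : X → Y → W)
  (run-node : ∀ h P Q x y → run (node h P Q) x y ≡ (if h (view x y) then run P x y else run Q x y))
  (cost-node : ∀ h P Q → cost (node h P Q) ≡ suc (cost P ⊔ cost Q))
  where

  send : ℕ → (W → ℕ) → (ℕ → Protocol X Y Z) → Protocol X Y Z
  send zero    g k = k 0
  send (suc l) g k = node (λ w → does (g w <? 2 ^ l)) (send l g k)
                          (send l (λ w → g w ∸ 2 ^ l) (λ i → k (2 ^ l + i)))

  run-send : ∀ l g k x y → g (view x y) < 2 ^ l → run (send l g k) x y ≡ run (k (g (view x y))) x y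
  run-send zero    g k x y g<1 = cong (λ i → run (k i) x y) (sym (n<1⇒n≡0 g<1))
  run-send (suc l) g k x y g< =
    trans (run-node _ (send l g k) (send l g′ k′) x y) (branch (g (view x y) <? 2 ^ l))
    where
    g′ : W → ℕ
    g′ w = g w ∸ 2 ^ l
    k′ : ℕ → Protocol X Y Z
    k′ i = k (2 ^ l + i)
    branch : (lt? : Dec (g (view x y) < 2 ^ l)) →
      (if does lt? then run (send l g k) x y else run (send l g′ k′) x y) ≡ run (k (g (view x y))) x y
    branch (yes lt) = run-send l g k x y lt
    branch (no ≮)   = trans (run-send l g′ k′ x y g′<) (cong (λ i → run (k i) x y) back)
      where
      back : 2 ^ l + g′ (view x y) ≡ g (view x y)
      back = m+[n∸m]≡n (≮⇒≥ ≮)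
      g′< : g′ (view x y) < 2 ^ l
      g′< = +-cancelˡ-< (2 ^ l) _ _ (subst₂ _<_ (sym back) (cong (2 ^ l +_) (+-identityʳ (2 ^ l))) g<)

  cost-send : ∀ l g k {m} → (∀ i → cost (k i) ≤ m) → cost (send l g k) ≤ l + m
  cost-send zero    g k h = h 0
  cost-send (suc l) g k h = ≤-trans (≤-reflexive (cost-node _ (send l g k) _))
    (s≤s (⊔-lub (cost-send l g k h) (cost-send l _ _ λ i → h (2 ^ l + i))))

  module _ (_≟_ : DecidableEquality W) where
    open Position _≟_

    sendFrom : ℕ → W → List W → (W → Protocol X Y Z) → Protocol X Y Z
    sendFrom l z ws k = send l (position ws) (k ∘ nth z ws)

    run-sendFrom : ∀ l z ws k x y → length ws ≤ 2 ^ l → view x y ∈ ws →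
      run (sendFrom l z ws k) x y ≡ run (k (view x y)) x y
    run-sendFrom l z ws k x y len v∈ =
      trans (run-send l _ (k ∘ nth z ws) x y (≤-trans (position<length v∈) len))
            (cong (λ w → run (k w) x y) (nth-position z v∈))

module _ {n} {f : BoolFun₂ n} (inv : ProfileInvariant f) (l m : ℕ) (n<2^l : n < 2 ^ l)
  (jump⇒extreme : ∀ {a b c d} → Jump f a b c d → Extreme n m (suc (a + b)) ⊎ Extreme n m (suc (a + c)))
  where

  private
    V = Vec Bool n
    _≟_ : DecidableEquality V
    _≟_ = ≡-dec _≟ᵇ_

    module A = Speak {V} {V} {V} {Sign} alice (λ x y → x) (λ _ _ _ _ _ → refl) (λ _ _ _ → refl)
    module B = Speak {V} {V} {V} {Sign} bob (λ x y → y) (λ _ _ _ _ _ → refl) (λ _ _ _ → refl)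

    isPlus : Sign → Bool
    isPlus Sign.+ = true
    isPlus Sign.- = false

    isPlus-correct : ∀ s {x y : V} →
      (if isPlus s then run (output Sign.+) x y else run (output Sign.-) x y) ≡ s
    isPlus-correct Sign.+ = refl
    isPlus-correct Sign.- = refl

    bobAnswers aliceAnswers : V → Protocol V V Sign
    bobAnswers   x = bob   (λ y → isPlus (f x y)) (output Sign.+) (output Sign.-)
    aliceAnswers y = alice (λ x → isPlus (f x y)) (output Sign.+) (output Sign.-)

    bits : ℕ
    bits = suc (l * m)
    o : V
    o = replicate n false

    ofWeight : ℕ → V
    ofWeight v = proj₁ (canonical n v 0 0)

    weight-ofWeight : ∀ {v} → v ≤ n → weight (ofWeight v) ≡ v
    weight-ofWeight {v} v≤n = trans (profile-weightˡ (canonical-profile n {v} {0} {0} {n ∸ v}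
      (sym (trans (cong (_+ (n ∸ v)) (+-identityʳ v)) (m+[n∸m]≡n v≤n))))) (+-identityʳ v)

    finish : ∀ v w → Dec (Extreme n m v) → Dec (Extreme n m w) → Protocol V V Sign
    finish v w (yes _) _       = A.sendFrom _≟_ bits o (extremes n m) bobAnswers
    finish v w (no _)  (yes _) = B.sendFrom _≟_ bits o (extremes n m) aliceAnswers
    finish v w (no _)  (no _)  = output (f (ofWeight v) (ofWeight w))

    finish-cost : ∀ v w p q → cost (finish v w p q) ≤ bits + 1
    finish-cost v w (yes _) _       = A.cost-send bits _ _ λ _ → ≤-refl
    finish-cost v w (no _)  (yes _) = B.cost-send bits _ _ λ _ → ≤-refl
    finish-cost v w (no _)  (no _)  = z≤n

    weight≤ : (x : V) → weight x ≤ n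
    weight≤ x = ≤-trans (m≤n+m (weight x) _) (≤-reflexive (weight-not x))

    finish-correct : ∀ x y p q → run (finish (weight x) (weight y) p q) x y ≡ f x y
    finish-correct x y (yes e) _ = trans
      (A.run-sendFrom _≟_ bits o _ bobAnswers x y (length-extremes n m {l} n<2^l) (∈-extremes x m e))
      (isPlus-correct (f x y) {x} {y})
    finish-correct x y (no _) (yes e) = trans
      (B.run-sendFrom _≟_ bits o _ aliceAnswers x y (length-extremes n m {l} n<2^l) (∈-extremes y m e))
      (isPlus-correct (f x y) {x} {y})
    finish-correct x y (no ¬v) (no ¬w) =
      noJump⇒constant {f = f} inv (weight x) (weight y) noJump _ _ x y
        (weight-ofWeight (weight≤ x)) (weight-ofWeight (weight≤ y)) refl refl
      where
      noJump : ∀ {a b c d} → suc (a + b) ≡ weight x → suc (a + c) ≡ weight y → ¬ Jump f a b c d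
      noJump ev ew J with jump⇒extreme J
      ... | inj₁ e = ¬v (subst (Extreme n m) ev e)
      ... | inj₂ e = ¬w (subst (Extreme n m) ew e)

    protocol : Protocol V V Sign
    protocol = A.send l weight λ v → B.send l weight λ w → finish v w (extreme? n m v) (extreme? n m w)

  cheapProtocol : ∃[ P ] Computes P f × cost P ≤ l + (l + (suc (l * m) + 1))
  cheapProtocol = protocol
    , (λ x y → trans (A.run-send l weight _ x y (≤-<-trans (weight≤ x) n<2^l))
              (trans (B.run-send l weight _ x y (≤-<-trans (weight≤ y) n<2^l))
                     (finish-correct x y (extreme? n m (weight x)) (extreme? n m (weight y)))))
    , A.cost-send l weight _ λ v → B.cost-send l weight _ λ w →
        finish-cost v w (extreme? n m v) (extreme? n m w)

power-between : ∀ l → 1 ≤ l → ∃[ k ] l < 2 ^ k × 2 ^ k ≤ 2 * l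
power-between (suc zero) _ = 1 , ≤-refl , ≤-refl
power-between (suc (suc l)) _ with power-between (suc l) (s≤s z≤n)
... | k , lo , hi with 2 + l <? 2 ^ k
...   | yes lt = k , lt , ≤-trans hi (*-monoʳ-≤ 2 (n≤1+n (suc l)))
...   | no ≮ with ≤-antisym lo (≮⇒≥ ≮)
...     | e = suc k
  , subst (λ j → 2 + l < 2 * j) e (m<m+n (2 + l) (s≤s z≤n))
  , ≤-reflexive (cong (2 *_) (sym e))

r<2^[1+log] : ∀ r → r < 2 ^ suc ⌊log₂ r ⌋
r<2^[1+log] r with r <? 2 ^ suc ⌊log₂ r ⌋
... | yes lt = lt
... | no ≮ = contradiction
  (≤-trans (≤-reflexive (sym (⌊log₂[2^n]⌋≡n (suc ⌊log₂ r ⌋)))) (⌊log₂⌋-mono-≤ (≮⇒≥ ≮))) 1+n≰n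

cost≤ : ∀ l → 1 ≤ l → let L = l + 3 in L + (L + (suc (L * (6 * l)) + 1)) ≤ 34 * l ^ 2
cost≤ (suc l) _ = ≤-trans (m≤m+n _ (28 * (l * l) + 36 * l)) (≤-reflexive (expand l))
  where
  expand : ∀ l → suc l + 3 + (suc l + 3 + (suc ((suc l + 3) * (6 * suc l)) + 1)) + (28 * (l * l) + 36 * l)
    ≡ 34 * (suc l * (suc l * 1))
  expand = ℕ-Solver.solve-∀

module _ {n r} {f : BoolFun₂ n} (inv : ProfileInvariant f) (bound : RankBound f r) where

  jump⇒extreme : 2 ≤ r → ∀ {a b c d} → Jump f a b c d →
    let m = 6 * ⌊log₂ r ⌋ in Extreme n m (suc (a + b)) ⊎ Extreme n m (suc (a + c))
  jump⇒extreme 2≤r {a} {b} {c} {d} J@(jump P _ _) =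
    decidable-stable (extreme? n m (suc (a + b)) ⊎-dec extreme? n m (suc (a + c))) λ ¬e →
      <⇒≱ (<-≤-trans (r<2^[1+log] r) (^-monoʳ-≤ 2 l<2^k))
        (rank-exponential {f = f} inv bound k
          (large λ le → ¬e (inj₁ (inj₁ le)))
          (large λ le → ¬e (inj₂ (inj₁ le)))
          (large λ le → ¬e (inj₂ (inj₂ (subst (_≤ m) (sym (n∸y a b c d (profile-length P))) le))))
          (large λ le → ¬e (inj₁ (inj₂ (subst (_≤ m) (sym (n∸x a b c d (profile-length P))) le))))
          J)
    where
    l = ⌊log₂ r ⌋
    m = 6 * l
    choice = power-between l (⌊log₂⌋-mono-≤ 2≤r)
    k = proj₁ choice
    l<2^k = proj₁ (proj₂ choice)
    large : ∀ {s} → ¬ (s ≤ m) → 3 * 2 ^ k ≤ s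
    large s≰m = ≤-trans (*-monoʳ-≤ 3 (proj₂ (proj₂ choice)))
      (≤-trans (≤-reflexive (sym (*-assoc 3 2 l))) (<⇒≤ (≰⇒> s≰m)))
    n∸x : ∀ a b c d → n ≡ (a + suc b) + (suc c + d) → n ∸ suc (a + b) ≡ suc (d + c)
    n∸x a b c d e = trans (cong (_∸ suc (a + b)) (trans e (arrange a b c d))) (m+n∸m≡n (suc (a + b)) _)
      where
      arrange : ∀ a b c d → (a + suc b) + (suc c + d) ≡ suc (a + b) + suc (d + c)
      arrange = ℕ-Solver.solve-∀
    n∸y : ∀ a b c d → n ≡ (a + suc b) + (suc c + d) → n ∸ suc (a + c) ≡ suc (d + b)
    n∸y a b c d e = n∸x a c b d (trans e (arrange a b c d))
      where
      arrange : ∀ a b c d → (a + suc b) + (suc c + d) ≡ (a + suc c) + (suc b + d)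
      arrange = ℕ-Solver.solve-∀

  jump⇒cheap : ∀ {a b c d} → Jump f a b c d → ∃[ P ] Computes P f × cost P ≤ 34 * ⌊log₂ r ⌋ ^ 2
  jump⇒cheap J =
    let l = ⌊log₂ r ⌋
        2≤r = 2≤rank {f = f} inv bound J
        (P , ok , c) = cheapProtocol {f = f} inv (l + 3) (6 * l) n<2^ (jump⇒extreme 2≤r)
    in P , ok , ≤-trans c (cost≤ l (⌊log₂⌋-mono-≤ 2≤r))
    where
    n<2^ : n < 2 ^ (⌊log₂ r ⌋ + 3)
    n<2^ = begin-strict
      n                                  ≤⟨ m≤m+n n 2 ⟩
      n + 2                              ≤⟨ n+2≤4rank {f = f} inv bound J ⟩
      4 * r                              <⟨ *-monoʳ-< 4 (r<2^[1+log] r) ⟩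
      4 * 2 ^ suc ⌊log₂ r ⌋              ≡⟨ ^-distribˡ-+-* 2 2 (suc ⌊log₂ r ⌋) ⟨
      2 ^ (3 + ⌊log₂ r ⌋)                ≡⟨ cong (2 ^_) (+-comm 3 ⌊log₂ r ⌋) ⟩
      2 ^ (⌊log₂ r ⌋ + 3)                ∎
      where open ≤-Reasoning

theorem1p9 : ∃[ C ] (∀ (n : ℕ) (f : BoolFun₂ n) →
    PermutationInvariant f → NonTrivial f →
    ∀ (d r : ℕ) → IsCommunicationComplexity f d → IsRank (inputMatrix f) r →
    d ≤ C * ⌊log₂ r ⌋ ^ 2)
theorem1p9 = 34 , λ n f perm nontrivial d r complexity rank →
  decidable-stable (d ≤? _) λ d≰ → nontrivial λ x y x′ y′ ex ey →
    noJump⇒constant {f = f} (profileInvariant perm) (weight x) (weight y)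
      (λ _ _ J → d≰ (let (P , ok , c) = jump⇒cheap {f = f} (profileInvariant perm) (IsRank.maximal rank) J
                   in ≤-trans (IsCommunicationComplexity.minimal complexity P ok) c))
      x y x′ y′ refl refl (sym ex) (sym ey)
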